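{- Let $k$ be a positive integer and let $D$ be an oriented graph. If $D$ is both $k$-anti-transitive and $(k-4)$-free, then $D$ has a Seymour vertex, i.e. there is a vertex $v \in V(D)$ with $d^+(v) \leq d^{++}(v)$.
   Context: A digraph $D=(V,E)$ has a non-empty vertex set $V=V(D)$ and arc set $E=E(D)\subseteq V\times V$. An oriented graph is a finite digraph with no loops ($(u,u)\notin E$) and with at most one arc between any two vertices (so $(u,v)$ and $(v,u)$ are never both in $E$). Directed paths and directed cycles have pairwise distinct vertices (apart from the coinciding endpoints of a cycle); the length of a directed path or cycle is its number of arcs. The distance $\mathrm{dist}(v,u)$ is the length of a shortest directed path from $v$ to $u$. For a vertex $v$, $N^+(v)=\{u\in V : \mathrm{dist}(v,u)=1\}$, $d^+(v)=|N^+(v)|$, $N^{++}(v)=\{w\in V:\mathrm{dist}(v,w)=2\}$ and $d^{++}(v)=|N^{++}(v)|$. A Seymour vertex is a vertex $v$ with $d^+(v)\leq d^{++}(v)$. A digraph $D$ is $k$-anti-transitive if for every pair of vertices $u,v\in V(D)$, the existence of a directed path of length $k$ from $u$ to $v$ implies $(u,v)\notin E(D)$. A digraph is $m$-free if it has no directed cycle of length at most $m$ (for an oriented graph this is a vacuous condition when $m\leq 2$). -}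

module Defs where

open import Data.Fin using (Fin; _≟_)
open import Data.Fin.Properties using (any?)
open import Data.Fin.Subset using (Subset; ∣_∣)
open import Data.Nat using (ℕ; zero; suc; _≤_; NonZero)
open import Data.Nat.Properties using (allUpTo?; ≮⇒≥; <⇒≱)
open import Data.Product using (∃; _×_; _,_)
open import Data.Vec using (Vec; []; _∷_; head; last; init; tabulate)
open import Data.Vec.Relation.Unary.AllPairs using (allPairs?)
open import Data.Vec.Relation.Unary.Linked using (Linked; linked?)
open import Data.Vec.Relation.Unary.Unique.Propositional using (Unique)
open import Level using (0ℓ)
open import Relation.Binary using (Rel; Decidable)
open import Relation.Binary.PropositionalEquality using (_≡_)
open import Relation.Nullary using (¬_; Dec; does)
open import Relation.Nullary.Decidable using (map′; ¬?; _×-dec_)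
import Relation.Unary as Unary

-- A finite digraph with vertex set Fin order.  The arc set is a decidable
-- relation, so that classically every finite digraph is of this form and the
-- out-neighbourhoods below are genuine finite sets with a cardinality.
record Digraph : Set₁ where
  field
    order         : ℕ
    .{{nonEmpty}} : NonZero order
    Arc           : Rel (Fin order) 0ℓ
    arc?          : Decidable Arc

  Vertex : Set
  Vertex = Fin order

record IsOriented (D : Digraph) : Set where
  open Digraph D
  field
    noLoops  : ∀ {u} → ¬ Arc u u
    noDigons : ∀ {u v} → Arc u v → ¬ Arc v u

module _ (D : Digraph) where
  open Digraph D

  record DirectedPath (u v : Vertex) (len : ℕ) : Set where
    constructor mkPath
    field
      vertices : Vec Vertex (suc len)
      starts   : head vertices ≡ u
      ends     : last vertices ≡ v
      arcs     : Linked Arc vertices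
      distinct : Unique vertices

  -- The common endpoint is listed both first and last, so that a cycle with
  -- len arcs has len + 1 entries, of which the first len are distinct.
  record DirectedCycle (len : ℕ) : Set where
    constructor mkCycle
    field
      .{{positive}} : NonZero len
      vertices      : Vec Vertex (suc len)
      closed        : head vertices ≡ last vertices
      arcs          : Linked Arc vertices
      distinct      : Unique (init vertices)

  -- dist(u,v) = d, as a relation: v need not be reachable from u.
  Dist : Vertex → Vertex → ℕ → Set
  Dist u v d = DirectedPath u v d × (∀ l → DirectedPath u v l → d ≤ l)

  AntiTransitive : ℕ → Set
  AntiTransitive k = ∀ u v → DirectedPath u v k → ¬ Arc u v

  -- Cycles have positive length, so Free 0 holds vacuously, just as Free m
  -- would for a negative m; hence Free (k ∸ 4) is (k - 4)-freeness for all k.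
  Free : ℕ → Set
  Free m = ∀ l → l ≤ m → ¬ DirectedCycle l

  private
    anyVec? : ∀ {m} {P : Unary.Pred (Vec Vertex m) 0ℓ} →
              Unary.Decidable P → Dec (∃ P)
    anyVec? {zero}  P? = map′ ([] ,_) (λ { ([] , p) → p }) (P? [])
    anyVec? {suc m} P? =
      map′ (λ { (x , xs , p) → (x ∷ xs) , p })
           (λ { ((x ∷ xs) , p) → x , xs , p })
           (any? (λ x → anyVec? (λ xs → P? (x ∷ xs))))

  directedPath? : ∀ u v len → Dec (DirectedPath u v len)
  directedPath? u v len =
    map′ (λ { (xs , s , e , a , d) → mkPath xs s e a d })
         (λ { (mkPath xs s e a d) → xs , s , e , a , d })
         (anyVec? (λ xs → (head xs ≟ u) ×-dec (last xs ≟ v)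
                    ×-dec linked? arc? xs
                    ×-dec allPairs? (λ x y → ¬? (x ≟ y)) xs))

  dist? : ∀ u v d → Dec (Dist u v d)
  dist? u v d =
    map′ (λ { (p , shorter) → p , λ l q → ≮⇒≥ (λ l<d → shorter {l} l<d q) })
         (λ { (p , minimal) → p , λ {l} l<d q → <⇒≱ l<d (minimal l q) })
         (directedPath? u v d
           ×-dec allUpTo? (λ l → ¬? (directedPath? u v l)) d)

  atDistance : ℕ → Vertex → Subset order
  atDistance d v = tabulate (λ u → does (dist? v u d))

  N⁺ N⁺⁺ : Vertex → Subset order
  N⁺  = atDistance 1
  N⁺⁺ = atDistance 2

  d⁺ d⁺⁺ : Vertex → ℕ
  d⁺  v = ∣ N⁺ v ∣
  d⁺⁺ v = ∣ N⁺⁺ v ∣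

  SeymourVertex : Vertex → Set
  SeymourVertex v = d⁺ v ≤ d⁺⁺ v

module Submission where

-- Suppose no vertex is a Seymour vertex and let v have minimum out-degree d, so
-- that |N⁺⁺(v)| < d.  Every x ∈ N⁺(v) has an out-neighbour in N⁺(v), since
-- otherwise N⁺(x) ⊆ N⁺⁺(v); and k-anti-transitivity forbids paths with k vertices
-- inside N⁺(v), while closed walks have length at least k - 3.
--
-- First, some s ∈ N⁺(v) has exactly one out-neighbour p in N⁺(v).  Otherwise
-- N⁺(v) induces minimum out-degree at least 2.  For k ≥ 7 a shortest cycle, of
-- length ℓ ≥ k - 3, can then be rerouted into a path with ℓ + 3 vertices.  For
-- k ≤ 6 one finds a regular tournament on five vertices in N⁺(v), and counting its
-- out-neighbours in N⁺⁺(v) gives a contradiction.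
--
-- For such s one has N⁺(s) = {p} ∪ N⁺⁺(v), and s has minimum out-degree again.
-- If every w ∈ N⁺⁺(v) had an out-neighbour in N⁺⁺(v), a walk from s inside N⁺(v)
-- followed by one inside N⁺⁺(v) would be a path of length k ending in N⁺(s).  So
-- some w ∈ N⁺⁺(v) has p as its only out-neighbour in N⁺(s), and (s, w) replaces
-- (v, s) with the same p.  Iterating yields a cycle inside N⁻(p) on which each
-- out-neighbour of p is an out-neighbour of every second vertex; going around this
-- cycle, then to p and on to its out-neighbours, gives the final forbidden path.

open import Defs
open import Data.Bool using (true; false)
open import Data.Empty using (⊥; ⊥-elim)
open import Data.Fin using (Fin; zero; suc; _≟_)
open import Data.Fin.Properties using (any?)
open import Data.Fin.Subset using (Subset; ∣_∣; _∈_; _⊆_; _∪_; _∩_; _-_; ⁅_⁆)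
open import Data.Fin.Subset.Properties
  using ( _∈?_; p⊆q⇒∣p∣≤∣q∣; p⊂q⇒∣p∣<∣q∣; x∈p⇒∣p-x∣<∣p∣; x∈p∧x≢y⇒x∈p-y; x∈p∪q⁺; x∈p∪q⁻; x∈p∩q⁺
        ; x∈p∩q⁻; x∈⁅x⁆; ∣⁅x⁆∣≡1; ∣p∩q∣≤∣q∣ )
open import Data.List using (List; []; _∷_; _++_; length; _∷ʳ_)
open import Data.List.Properties using (length-++)
open import Data.List.Membership.Propositional using () renaming (_∈_ to _∈ˡ_)
open import Data.List.Membership.Propositional.Properties using (∈-++⁺ˡ; ∈-++⁺ʳ)
import Data.List.Membership.DecPropositional as DecMembership
open import Data.List.Relation.Unary.All as All using (All; []; _∷_)
import Data.List.Relation.Unary.All.Properties as Allₚ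
open import Data.List.Relation.Unary.Any using (here; there)
open import Data.List.Relation.Unary.AllPairs using ([]; _∷_)
import Data.List.Relation.Unary.AllPairs.Properties as AllPairsₚ
open import Data.List.Relation.Unary.Unique.Propositional using (Unique)
open import Data.Nat using (ℕ; zero; suc; _+_; _∸_; _≤_; _<_; z≤n; s≤s; NonZero; >-nonZero⁻¹)
open import Data.Nat.Properties
  using ( ≤-refl; ≤-trans; ≤-reflexive; ≤-pred; ≤-antisym; <⇒≤; <⇒≱; <-irrefl; ≤-<-trans
        ; m≤n⇒m≤1+n; m≤n⇒m<n∨m≡n; n≤1+n; n<1+n; m≤m+n; +-comm; +-suc; +-mono-≤; +-monoʳ-≤
        ; ≰⇒>; ≮⇒≥; m+[n∸m]≡n; ∸-monoˡ-≤; m≤n+m∸n; _≤?_; +-cancelˡ-≤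
        ; module ≤-Reasoning)
open import Data.Product using (∃; ∃₂; _×_; _,_; proj₁; proj₂)
open import Data.Sum using (_⊎_; inj₁; inj₂; [_,_]′)
open import Data.Vec as Vec using (Vec; []; _∷_; head; last)
open import Data.Vec.Properties using (last-∷ʳ; init-∷ʳ; lookup∘tabulate; lookup⇒[]=; []=⇒lookup)
import Data.Vec.Relation.Unary.All as VecAll
import Data.Vec.Relation.Unary.Linked as VecLinked
import Data.Vec.Relation.Unary.Unique.Propositional as VecUnique
open import Function using (_∘_)
open import Level using (0ℓ)
open import Relation.Binary using (Rel; DecidableEquality)
open import Relation.Binary.PropositionalEquality
  using (_≡_; _≢_; refl; sym; trans; cong; subst; ≢-sym)
open import Relation.Nullary using (¬_; Dec; yes; no; does; contradiction)
open import Relation.Nullary.Decidable using (¬?; _×-dec_; dec-true; decidable-stable)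

-- Walks, paths and girth

-- The list holds the vertices before the last one, latest first.
data Walk {V : Set} (R : Rel V 0ℓ) (x : V) : List V → V → Set where
  stop : Walk R x [] x
  _▷_  : ∀ {ys y z} → Walk R x ys y → R y z → Walk R x (y ∷ ys) z

infixl 5 _▷_

Path : {V : Set} → Rel V 0ℓ → V → List V → V → Set
Path R x ys y = Walk R x ys y × Unique (y ∷ ys)

-- For g ≥ 1 this says that every closed walk, hence every directed cycle, has
-- at least g arcs.
Girth≥ : {V : Set} → Rel V 0ℓ → ℕ → Set
Girth≥ R g = ∀ {x ys y} → Walk R x ys y → R y x → g ≤ suc (length ys)

module _ {V : Set} {R : Rel V 0ℓ} where

  infixl 5 _▷▷_

  _▷▷_ : ∀ {x ys y zs z} → Walk R x ys y → Walk R y zs z → Walk R x (zs ++ ys) z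
  p ▷▷ stop    = p
  p ▷▷ (q ▷ r) = (p ▷▷ q) ▷ r

  fresh▷ : ∀ {x ys y z} → Path R x ys y → R y z → All (z ≢_) (y ∷ ys) → Path R x (y ∷ ys) z
  fresh▷ (p , u) r f = (p ▷ r) , f ∷ u

  map-walk : ∀ {S : Rel V 0ℓ} → (∀ {a b} → R a b → S a b) →
             ∀ {x ys y} → Walk R x ys y → Walk S x ys y
  map-walk f stop    = stop
  map-walk f (p ▷ r) = map-walk f p ▷ f r

  all-sources : ∀ {P : V → Set} → (∀ {a b} → R a b → P a) →
                ∀ {x ys y} → Walk R x ys y → All P ys
  all-sources f stop    = []
  all-sources f (p ▷ r) = f r ∷ all-sources f p

  split : ∀ {x zs z y} → Walk R x zs z → y ∈ˡ zs →
          ∃₂ λ us vs → Walk R x vs y × Walk R y us z × length us + length vs ≡ length zs × 1 ≤ length us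
  split (p ▷ r) (here refl) = _ , _ , p , (stop ▷ r) , refl , s≤s z≤n
  split (p ▷ r) (there m) with split p m
  ... | us , vs , a , b , e , l = _ , _ , a , (b ▷ r) , cong suc e , s≤s z≤n

  initial : ∀ {x ys y} i → i ≤ length ys → Path R x ys y → ∃₂ λ zs z → Path R x zs z × length zs ≡ i
  initial {ys = ys} i i≤ p with m≤n⇒m<n∨m≡n i≤
  ... | inj₂ e = _ , _ , p , sym e
  initial {ys = y ∷ ys} i i≤ ((p ▷ r) , (_ ∷ u)) | inj₁ i< = initial i (≤-pred i<) (p , u)

  -- Walks grow at their end; this exposes the other end, which is needed to move the base point of
  -- a closed walk.
  first-arc : ∀ {x zs u z} → Walk R x (u ∷ zs) z →
              ∃₂ λ y ys → R x y × Walk R y ys z × u ∷ zs ≡ ys ∷ʳ x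
  first-arc (stop ▷ r)      = _ , _ , r , stop , refl
  first-arc (p@(_ ▷ _) ▷ r) with first-arc p
  ... | y , ys , a , w , e = y , _ , a , (w ▷ r) , cong (_ ∷_) e

module _ {V : Set} (_≟ᵛ_ : DecidableEquality V) {R : Rel V 0ℓ} where

  open DecMembership _≟ᵛ_ using () renaming (_∈?_ to _∈ˡ?_)

  -- A repeated vertex would cut out a closed walk with at most `length ys` arcs, which is below the
  -- girth.
  short-walk-path : ∀ {g} → Girth≥ R g → ∀ {x ys y} → Walk R x ys y → length ys < g → Path R x ys y
  short-walk-path girth stop l = stop , [] ∷ []
  short-walk-path girth {y = z} w@(_▷_ {ys = ys} {y} p r) l
    with short-walk-path girth p (<⇒≤ l) | z ∈ˡ? (y ∷ ys)
  ... | _ , u | no  z∉ = w , Allₚ.¬Any⇒All¬ _ z∉ ∷ u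
  ... | _ , u | yes z∈ with split w z∈
  ... | suc-us@(_ ∷ us) , vs , _ , (q ▷ s) , e , _ =
    contradiction (girth q s) (<⇒≱ (≤-<-trans (≤-trans (m≤m+n _ (length vs)) (≤-reflexive e)) l))

  -- Without closed walks every girth bound holds, so one above the length of the walk is chosen.
  acyclic-walk-path : (∀ {x ys y} → Walk R x ys y → ¬ R y x) →
                      ∀ {x ys y} → Walk R x ys y → Path R x ys y
  acyclic-walk-path acyclic {ys = ys} w =
    short-walk-path {g = suc (length ys)} (λ p r → ⊥-elim (acyclic p r)) w (n<1+n _)

  -- A closed walk with exactly `g` arcs repeats no vertex by `short-walk-path`, so only cycles have
  -- to be excluded. This is the induction step by which girth bounds are raised.
  Girth≥-suc : ∀ {g} → Girth≥ R g → (∀ {x ys y} → Path R x ys y → R y x → suc (length ys) ≢ g) →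
               Girth≥ R (suc g)
  Girth≥-suc girth noCycle p r with m≤n⇒m<n∨m≡n (girth p r)
  ... | inj₁ lt = lt
  ... | inj₂ eq = contradiction (sym eq)
                    (noCycle (short-walk-path girth p (≤-reflexive (sym eq))) r)

-- Cardinalities of finite subsets

∣∪∣≤ : ∀ {n} (p q : Subset n) → ∣ p ∪ q ∣ ≤ ∣ p ∣ + ∣ q ∣
∣∪∣≤ []           []           = z≤n
∣∪∣≤ (false ∷ p) (false ∷ q) = ∣∪∣≤ p q
∣∪∣≤ (false ∷ p) (true  ∷ q) = ≤-trans (s≤s (∣∪∣≤ p q)) (≤-reflexive (sym (+-suc ∣ p ∣ ∣ q ∣)))
∣∪∣≤ (true  ∷ p) (false ∷ q) = s≤s (∣∪∣≤ p q)
∣∪∣≤ (true  ∷ p) (true  ∷ q) = s≤s (≤-trans (∣∪∣≤ p q) (+-monoʳ-≤ ∣ p ∣ (n≤1+n _)))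

∣p∣+∣q∣≤∣p∪q∣+∣p∩q∣ : ∀ {n} (p q : Subset n) → ∣ p ∣ + ∣ q ∣ ≤ ∣ p ∪ q ∣ + ∣ p ∩ q ∣
∣p∣+∣q∣≤∣p∪q∣+∣p∩q∣ []           []           = z≤n
∣p∣+∣q∣≤∣p∪q∣+∣p∩q∣ (false ∷ p) (false ∷ q) = ∣p∣+∣q∣≤∣p∪q∣+∣p∩q∣ p q
∣p∣+∣q∣≤∣p∪q∣+∣p∩q∣ (false ∷ p) (true  ∷ q) =
  ≤-trans (≤-reflexive (+-suc ∣ p ∣ ∣ q ∣)) (s≤s (∣p∣+∣q∣≤∣p∪q∣+∣p∩q∣ p q))
∣p∣+∣q∣≤∣p∪q∣+∣p∩q∣ (true  ∷ p) (false ∷ q) = s≤s (∣p∣+∣q∣≤∣p∪q∣+∣p∩q∣ p q)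
∣p∣+∣q∣≤∣p∪q∣+∣p∩q∣ (true  ∷ p) (true  ∷ q) =
  s≤s (≤-trans (≤-reflexive (+-suc ∣ p ∣ ∣ q ∣))
       (≤-trans (s≤s (∣p∣+∣q∣≤∣p∪q∣+∣p∩q∣ p q)) (≤-reflexive (sym (+-suc ∣ p ∪ q ∣ ∣ p ∩ q ∣)))))

p⊆⁅x⁆∪q⇒∣p∣≤1+∣q∣ : ∀ {n} {p q : Subset n} x → (∀ {y} → y ∈ p → y ≢ x → y ∈ q) → ∣ p ∣ ≤ suc ∣ q ∣
p⊆⁅x⁆∪q⇒∣p∣≤1+∣q∣ {p = p} {q} x f = begin
  ∣ p ∣               ≤⟨ p⊆q⇒∣p∣≤∣q∣ covered ⟩
  ∣ ⁅ x ⁆ ∪ q ∣       ≤⟨ ∣∪∣≤ ⁅ x ⁆ q ⟩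
  ∣ ⁅ x ⁆ ∣ + ∣ q ∣   ≡⟨ cong (_+ ∣ q ∣) (∣⁅x⁆∣≡1 x) ⟩
  suc ∣ q ∣           ∎
  where
  open ≤-Reasoning
  covered : p ⊆ ⁅ x ⁆ ∪ q
  covered {y} y∈p with y ≟ x
  ... | yes refl = x∈p∪q⁺ (inj₁ (x∈⁅x⁆ x))
  ... | no  y≢x  = x∈p∪q⁺ (inj₂ (f y∈p y≢x))

length≤∣p∣ : ∀ {n} {p : Subset n} (xs : List (Fin n)) → Unique xs → All (_∈ p) xs → length xs ≤ ∣ p ∣
length≤∣p∣ []       _       _        = z≤n
length≤∣p∣ (x ∷ xs) (f ∷ u) (m ∷ ms) =
  ≤-trans (s≤s (length≤∣p∣ xs u (All.zipWith (λ (x≢y , y∈p) → x∈p∧x≢y⇒x∈p-y y∈p (≢-sym x≢y)) (f , ms))))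
          (x∈p⇒∣p-x∣<∣p∣ m)

-- The predicate `P` separates the two pieces, so distinctness across the join needs no further
-- check.
path-join : ∀ {V : Set} {R : Rel V 0ℓ} {P : V → Set} {x ys y z zs w} →
            Path R x ys y → All P (y ∷ ys) → R y z → Path R z zs w → All (¬_ ∘ P) (w ∷ zs) →
            Path R x (zs ++ y ∷ ys) w
path-join (p , u) ps r (q , u′) ¬ps =
  (p ▷ r ▷▷ q) ,
  AllPairsₚ.++⁺ u′ u (All.map (λ ¬p → All.map (λ p e → ¬p (subst _ (sym e) p)) ps) ¬ps)

-- Paths as vectors

module _ {V : Set} where

  toVec : (ys : List V) → V → Vec V (suc (length ys))
  toVec []       y = y ∷ []
  toVec (p ∷ ps) y = toVec ps p Vec.∷ʳ y

  last-toVec : ∀ ys y → last (toVec ys y) ≡ y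
  last-toVec []       y = refl
  last-toVec (p ∷ ps) y = last-∷ʳ y (toVec ps p)

  head-∷ʳ : ∀ {n} (v : Vec V (suc n)) y → head (v Vec.∷ʳ y) ≡ head v
  head-∷ʳ (x ∷ v) y = refl

  linked-∷ʳ : ∀ {R : Rel V 0ℓ} {n} {v : Vec V (suc n)} {y} →
              VecLinked.Linked R v → R (last v) y → VecLinked.Linked R (v Vec.∷ʳ y)
  linked-∷ʳ {v = x ∷ []}     VecLinked.[-]     r = r VecLinked.∷ VecLinked.[-]
  linked-∷ʳ {v = x ∷ z ∷ v} (s VecLinked.∷ l) r = s VecLinked.∷ linked-∷ʳ l r

  all-∷ʳ : ∀ {P : V → Set} {n} {v : Vec V n} {y} → VecAll.All P v → P y → VecAll.All P (v Vec.∷ʳ y)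
  all-∷ʳ VecAll.[]       q = q VecAll.∷ VecAll.[]
  all-∷ʳ (p VecAll.∷ ps) q = p VecAll.∷ all-∷ʳ ps q

  unique-∷ʳ : ∀ {n} {v : Vec V n} {y} →
              VecUnique.Unique v → VecAll.All (y ≢_) v → VecUnique.Unique (v Vec.∷ʳ y)
  unique-∷ʳ VecUnique.[]      VecAll.[]       = VecAll.[] VecUnique.∷ VecUnique.[]
  unique-∷ʳ (f VecUnique.∷ u) (g VecAll.∷ gs) = all-∷ʳ f (≢-sym g) VecUnique.∷ unique-∷ʳ u gs

  all-toVec : ∀ {P : V → Set} ys {y} → All P (y ∷ ys) → VecAll.All P (toVec ys y)
  all-toVec []       (p ∷ [])     = p VecAll.∷ VecAll.[]
  all-toVec (_ ∷ ps) (p ∷ q ∷ qs) = all-∷ʳ (all-toVec ps (q ∷ qs)) p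

  unique-toVec : ∀ ys {y} → Unique (y ∷ ys) → VecUnique.Unique (toVec ys y)
  unique-toVec []       _           = VecAll.[] VecUnique.∷ VecUnique.[]
  unique-toVec (p ∷ ps) (f ∷ g ∷ u) = unique-∷ʳ (unique-toVec ps (g ∷ u)) (all-toVec ps f)

  module _ {R : Rel V 0ℓ} where

    head-toVec : ∀ {x ys y} → Walk R x ys y → head (toVec ys y) ≡ x
    head-toVec stop    = refl
    head-toVec {ys = y ∷ ys} (p ▷ r) = trans (head-∷ʳ (toVec ys y) _) (head-toVec p)

    linked-toVec : ∀ {x ys y} → Walk R x ys y → VecLinked.Linked R (toVec ys y)
    linked-toVec stop = VecLinked.[-]
    linked-toVec {ys = y ∷ ys} (p ▷ r) =
      linked-∷ʳ (linked-toVec p) (subst (λ z → R z _) (sym (last-toVec ys y)) r)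

does-true : ∀ {A : Set} (a? : Dec A) → does a? ≡ true → A
does-true (yes a) _ = a

-- Girth and out-neighbourhoods in an oriented graph

module OrientedDigraph (D : Digraph) (oriented : IsOriented D) where
  open Digraph D
  open IsOriented oriented public

  path⇒directedPath : ∀ {x ys y} → Path Arc x ys y → DirectedPath D x y (length ys)
  path⇒directedPath {ys = ys} {y} (w , u) =
    mkPath (toVec ys y) (head-toVec w) (last-toVec ys y) (linked-toVec w) (unique-toVec ys u)

  path⇒directedCycle : ∀ {x ys y} → Path Arc x ys y → Arc y x → DirectedCycle D (suc (length ys))
  path⇒directedCycle {x} {ys} {y} (w , u) a =
    mkCycle (toVec (y ∷ ys) x)
      (trans (head-toVec (w ▷ a)) (sym (last-toVec (y ∷ ys) x)))
      (linked-toVec (w ▷ a))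
      (subst VecUnique.Unique (sym (init-∷ʳ x (toVec ys y))) (unique-toVec ys u))

  arc⇒≢ : ∀ {x y} → Arc x y → x ≢ y
  arc⇒≢ a refl = noLoops a

  girth≥3 : Girth≥ Arc 3
  girth≥3 stop             r = contradiction r noLoops
  girth≥3 (stop ▷ a)       r = contradiction r (noDigons a)
  girth≥3 (_ ▷ _ ▷ _)      r = s≤s (s≤s (s≤s z≤n))

  free⇒girth≥ : ∀ m → Free D m → Girth≥ Arc (suc m)
  free⇒girth≥ zero    free _ _ = s≤s z≤n
  free⇒girth≥ (suc m) free =
    Girth≥-suc _≟_ (free⇒girth≥ m (λ l l≤m → free l (m≤n⇒m≤1+n l≤m)))
      (λ p a l≡ → free _ (≤-reflexive l≡) (path⇒directedCycle p a))

  ∈atDistance⁻ : ∀ {d v u} → u ∈ atDistance D d v → Dist D v u d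
  ∈atDistance⁻ {d} {v} {u} m =
    does-true (dist? D v u d) (trans (sym (lookup∘tabulate _ u)) ([]=⇒lookup m))

  ∈atDistance⁺ : ∀ {d v u} → Dist D v u d → u ∈ atDistance D d v
  ∈atDistance⁺ {d} {v} {u} δ =
    lookup⇒[]= u _ (trans (lookup∘tabulate _ u) (dec-true (dist? D v u d) δ))

  path0⇒≡ : ∀ {v u} → DirectedPath D v u 0 → v ≡ u
  path0⇒≡ (mkPath (x ∷ []) refl refl _ _) = refl

  path1⇒arc : ∀ {v u} → DirectedPath D v u 1 → Arc v u
  path1⇒arc (mkPath (x ∷ y ∷ []) refl refl (a VecLinked.∷ _) _) = a

  arc⇒∈N⁺ : ∀ {v u} → Arc v u → u ∈ N⁺ D v
  arc⇒∈N⁺ a = ∈atDistance⁺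
    ( path⇒directedPath ((stop ▷ a) , (≢-sym (arc⇒≢ a) ∷ []) ∷ [] ∷ [])
    , λ { zero p → contradiction (path0⇒≡ p) (arc⇒≢ a) ; (suc l) _ → s≤s z≤n })

  ∈N⁺⇒arc : ∀ {v u} → u ∈ N⁺ D v → Arc v u
  ∈N⁺⇒arc m = path1⇒arc (proj₁ (∈atDistance⁻ m))

  second⇒∈N⁺⁺ : ∀ {v x u} → Arc v x → Arc x u → ¬ Arc v u → u ∈ N⁺⁺ D v
  second⇒∈N⁺⁺ {v} {x} {u} a b ¬c = ∈atDistance⁺
    ( path⇒directedPath (short-walk-path _≟_ girth≥3 (stop ▷ a ▷ b) ≤-refl)
    , λ { zero p → contradiction (subst (Arc x) (sym (path0⇒≡ p)) b) (noDigons a)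
        ; (suc zero) p → contradiction (path1⇒arc p) ¬c
        ; (suc (suc l)) _ → s≤s (s≤s z≤n) })

  ∈N⁺⁺⇒¬arc : ∀ {v u} → u ∈ N⁺⁺ D v → ¬ Arc v u
  ∈N⁺⁺⇒¬arc m a = contradiction
    (proj₂ (∈atDistance⁻ m) 1 (path⇒directedPath ((stop ▷ a) , (≢-sym (arc⇒≢ a) ∷ []) ∷ [] ∷ [])))
    (λ { (s≤s ()) })

-- Asymmetric relations of minimum out-degree two without long paths

module MinOutDegree2
  {V : Set} (_≟ᵛ_ : DecidableEquality V) (R : Rel V 0ℓ)
  (asym  : ∀ {x y} → R x y → ¬ R y x)
  -- Every vertex that is entered has at least two out-neighbours: one of them avoids any prescribed
  -- `c`.
  (other : ∀ {x y} → R x y → ∀ c → ∃ λ a → a ≢ c × R y a)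
  where

  open DecMembership _≟ᵛ_ using () renaming (_∈?_ to _∈ˡ?_)

  R⇒≢ : ∀ {x y} → R x y → x ≢ y
  R⇒≢ r refl = asym r r

  -- Rerouting a shortest closed walk

  module ShortestClosedWalk
    (noTriangle : ∀ {x y z} → R x y → R y z → ¬ R z x)
    (ℓ : ℕ) (girth : Girth≥ R ℓ)
    -- Counted in arcs: what is excluded are paths on `ℓ + 3` vertices.
    (noLongPath : ∀ {x ys y} → Path R x ys y → length ys < 2 + ℓ)
    where

    -- A closed walk x → a → b → c → ⋯ → x of the minimum length ℓ.
    record Frame (x a b c : V) (cs : List V) : Set where
      constructor frame
      field
        xa   : R x a
        ab   : R a b
        bc   : R b c
        rest : Walk R c cs x
        size : 3 + length cs ≡ ℓ

    Off : List V → V → Set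
    Off vs q = All (q ≢_) vs

    -- Shifts the base point from `x` to `a`. The vertices of the cycle get listed in another order,
    -- so being off the cycle is transported in both directions. The successor `d` of `c` is located
    -- for the last step of `noFrame`.
    rotate : ∀ {x a b c cs} → Frame x a b c cs →
             ∃₂ λ d ds → Frame a b c d ds × d ∈ˡ (x ∷ cs)
               × (∀ {q} → Off (a ∷ b ∷ c ∷ ds) q → Off (x ∷ a ∷ b ∷ cs) q)
               × (∀ {q} → Off (x ∷ a ∷ b ∷ cs) q → Off (a ∷ b ∷ c ∷ ds) q)
    rotate (frame xa ab bc stop size) = contradiction xa (noTriangle ab bc)
    rotate {x} {a} {b} {c} {u ∷ cs} (frame xa ab bc w@(_ ▷ _) size) with first-arc w
    ... | d , ds , cd , v , eq =
      d , x ∷ ds , frame ab bc cd (v ▷ xa) size′ , d∈ ds v eq , to , from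
      where
      size′ : 3 + length (x ∷ ds) ≡ ℓ
      size′ =
        trans (cong (3 +_) (sym (trans (cong length eq) (trans (length-++ ds) (+-comm (length ds) 1))))) size
      d∈ : ∀ ds → Walk R d ds x → u ∷ cs ≡ ds ∷ʳ c → d ∈ˡ (x ∷ u ∷ cs)
      d∈ [] stop _ = here refl
      d∈ (_ ∷ _) p@(_ ▷ _) e with first-arc p
      ... | _ , ys , _ , _ , e′ =
        there (subst (d ∈ˡ_) (sym e) (∈-++⁺ˡ (subst (d ∈ˡ_) (sym e′) (∈-++⁺ʳ ys (here refl)))))
      to : ∀ {q} → Off (a ∷ b ∷ c ∷ x ∷ ds) q → Off (x ∷ a ∷ b ∷ u ∷ cs) q
      to (≢a ∷ ≢b ∷ ≢c ∷ ≢x ∷ ≢ds) = ≢x ∷ ≢a ∷ ≢b ∷ subst (All _) (sym eq) (Allₚ.∷ʳ⁺ ≢ds ≢c)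
      from : ∀ {q} → Off (x ∷ a ∷ b ∷ u ∷ cs) q → Off (a ∷ b ∷ c ∷ x ∷ ds) q
      from (≢x ∷ ≢a ∷ ≢b ∷ ≢cs) with Allₚ.∷ʳ⁻ (subst (All _) eq ≢cs)
      ... | ≢ds , ≢c = ≢a ∷ ≢b ∷ ≢c ∷ ≢x ∷ ≢ds

    closed≥ : ∀ {x us q vs} → Walk R x us q → Walk R q vs x → 1 ≤ length vs → ℓ ≤ length vs + length us
    closed≥ {us = us} p (_▷_ {ys = vs} q r) _ =
      ≤-trans (girth (p ▷▷ q) r) (≤-reflexive (cong suc (length-++ vs)))

    -- By minimality of the closed walk, no walk from `x` to a vertex of the cycle is shorter than
    -- the way along the cycle. That way has at least three arcs for vertices of `cs`, with equality
    -- only for `c`.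
    reach-cs : ∀ {x a b c cs js q} → Frame x a b c cs → Walk R x js q → q ∈ˡ cs → length js ≤ 3 →
               3 ≤ length js × q ≡ c
    reach-cs {cs = cs} {js} (frame xa ab bc w size) p q∈ j≤3 with split w q∈
    ... | us , vs , cvq , qux , eq , 1≤us = ≤-trans (m≤m+n 3 _) lower , vs≡[] vs cvq (≤-trans lower j≤3)
      where
      lower : 3 + length vs ≤ length js
      lower = +-cancelˡ-≤ (length us) _ _ (begin
        length us + (3 + length vs)  ≡⟨ +-comm (length us) _ ⟩
        3 + length vs + length us    ≡⟨ cong (3 +_) (trans (+-comm (length vs) _) eq) ⟩
        3 + length cs                ≡⟨ size ⟩
        ℓ                            ≤⟨ closed≥ p qux 1≤us ⟩
        length us + length js        ∎)
        where open ≤-Reasoning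
      vs≡[] : ∀ vs → Walk R _ vs _ → 3 + length vs ≤ 3 → _ ≡ _
      vs≡[] [] stop _ = refl
      vs≡[] (_ ∷ _) _ (s≤s (s≤s (s≤s ())))

    not-in-cs : ∀ {x a b c cs js q} → Frame x a b c cs → Walk R x js q → length js ≤ 2 → All (q ≢_) cs
    not-in-cs {cs = cs} {q = q} F p j≤2 with q ∈ˡ? cs
    ... | no  q∉ = Allₚ.¬Any⇒All¬ cs q∉
    ... | yes q∈ = contradiction (proj₁ (reach-cs F p q∈ (m≤n⇒m≤1+n j≤2))) (<⇒≱ (s≤s j≤2))

    unique-abx : ∀ {x a b c cs} → Frame x a b c cs → Unique (b ∷ a ∷ x ∷ cs)
    unique-abx (frame xa ab bc w size) =
      proj₂ (short-walk-path _≟ᵛ_ girth (w ▷ xa ▷ ab) (≤-reflexive size))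

    -- Here and in the next two lemmas the cycle is followed up to `x`, starting at `b`, `a` or `c`.
    -- The skipped vertices stay free to be visited after a detour.
    path-b : ∀ {x a b c cs} → Frame x a b c cs → Path R b (cs ++ b ∷ []) x
    path-b {cs = cs} (frame xa ab bc w size) = short-walk-path _≟ᵛ_ girth (stop ▷ bc ▷▷ w)
      (≤-trans (≤-reflexive (cong suc (trans (length-++ cs) (+-comm (length cs) 1))))
               (≤-trans (n≤1+n _) (≤-reflexive size)))

    path-a : ∀ {x a b c cs} → Frame x a b c cs → Path R a (cs ++ b ∷ a ∷ []) x
    path-a {cs = cs} (frame xa ab bc w size) = short-walk-path _≟ᵛ_ girth (stop ▷ ab ▷ bc ▷▷ w)
      (≤-reflexive (trans (cong suc (trans (length-++ cs) (+-comm (length cs) 2))) size))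

    path-c : ∀ {x a b c cs} → Frame x a b c cs → Path R c cs x
    path-c F@(frame _ _ _ w _) with unique-abx F
    ... | _ ∷ _ ∷ u = w , u

    -- In terms of the frame, `5 + length cs` is the forbidden number `2 + ℓ` of arcs.
    tooLong : ∀ {x a b c cs y ys z} → Frame x a b c cs → Path R y ys z → ¬ 5 + length cs ≤ length ys
    tooLong F p l = <⇒≱ (noLongPath p) (≤-trans (≤-reflexive (cong (2 +_) (sym (Frame.size F)))) l)

    length-∷ʳ : ∀ cs (b : V) → suc (length cs) ≤ length (cs ++ b ∷ [])
    length-∷ʳ cs b = ≤-reflexive (sym (trans (length-++ cs) (+-comm (length cs) 1)))

    predecessor : ∀ {x a b c cs} → Frame x a b c cs → ∃ λ y → R y x
    predecessor (frame xa ab bc stop size)    = contradiction xa (noTriangle ab bc)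
    predecessor (frame xa ab bc (_ ▷ r) size) = _ , r

    -- An out-neighbour of `x` other than `a` lies off the cycle, since an arc from `x` to `b` or
    -- into `cs` would shorten the closed walk.
    exit : ∀ {x a b c cs} → Frame x a b c cs → ∃ λ q → R x q × Off (x ∷ a ∷ b ∷ cs) q
    exit {cs = cs} F@(frame xa ab bc w size) with other (proj₂ (predecessor F)) _
    ... | q , q≢a , xq = q , xq , ≢-sym (R⇒≢ xq) ∷ q≢a ∷ q≢b ∷ not-in-cs F (stop ▷ xq) (s≤s z≤n)
      where
      q≢b : q ≢ _
      q≢b refl = <⇒≱ (≤-reflexive size)
        (≤-trans (girth (stop ▷ bc ▷▷ w) xq)
          (≤-reflexive (cong suc (trans (length-++ cs) (+-comm (length cs) 1)))))

    exit-a : ∀ {x a b c cs} → Frame x a b c cs → ∃ λ q → R a q × Off (x ∷ a ∷ b ∷ cs) q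
    exit-a F with rotate F
    ... | _ , _ , G , _ , to , _ with exit G
    ... | q , aq , off = q , aq , to off

    exit-b : ∀ {x a b c cs} → Frame x a b c cs → ∃ λ q → R b q × Off (x ∷ a ∷ b ∷ cs) q
    exit-b F with rotate F
    ... | _ , _ , G , _ , to , _ with exit-a G
    ... | q , bq , off = q , bq , to off

    two-steps-off : ∀ {x a b c cs q r} → Frame x a b c cs → R x q → R q r →
                    r ≢ a → r ≢ b → Off (x ∷ a ∷ b ∷ cs) r
    two-steps-off F xq qr r≢a r≢b =
      (λ { refl → asym xq qr }) ∷ r≢a ∷ r≢b ∷ not-in-cs F (stop ▷ xq ▷ qr) ≤-refl

    -- Otherwise `q` fits between `x` and `a`, and with an exit `q′` of `a` the path
    -- `b → ⋯ → x → q → a → q′ → r` is too long. If `r` is `b`, then `q′` fits between `a` and `b`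
    -- as well, and `c → ⋯ → x → q → a → q′ → b → q″` is too long.
    exit-not-to-a : ∀ {x a b c cs q} → Frame x a b c cs → R x q → Off (x ∷ a ∷ b ∷ cs) q → ¬ R q a
    exit-not-to-a {x} {a} {b} {c} {cs} {q} F@(frame xa ab bc w size) xq (q≢x ∷ q≢a ∷ q≢b ∷ q≢cs) qa
      with unique-abx F | exit-a F | rotate F
    ... | (b≢a ∷ b≢x ∷ b≢cs) ∷ (a≢x ∷ a≢cs) ∷ _
        | q′ , aq′ , (q′≢x ∷ q′≢a ∷ q′≢b ∷ q′≢cs) | d , ds , G , _ , to , _
      with other aq′ c
    ... | r , r≢c , q′r with r ≟ᵛ b
    ... | no r≢b with to (two-steps-off G aq′ q′r r≢b r≢c)
    ... | r≢x ∷ r≢a ∷ _ ∷ r≢cs =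
      tooLong F
        (fresh▷ (fresh▷ (fresh▷ (fresh▷ (path-b F)
          xq (q≢x ∷ Allₚ.∷ʳ⁺ q≢cs q≢b))
          qa (≢-sym q≢a ∷ a≢x ∷ Allₚ.∷ʳ⁺ a≢cs (≢-sym b≢a)))
          aq′ (q′≢a ∷ q′≢q ∷ q′≢x ∷ Allₚ.∷ʳ⁺ q′≢cs q′≢b))
          q′r (≢-sym (R⇒≢ q′r) ∷ r≢a ∷ (λ { refl → noTriangle qa aq′ q′r }) ∷ r≢x ∷ Allₚ.∷ʳ⁺ r≢cs r≢b))
        (+-monoʳ-≤ 4 (length-∷ʳ cs b))
      where
      q′≢q : q′ ≢ q
      q′≢q refl = asym qa aq′
    exit-not-to-a {x} {a} {b} {c} {cs} {q} F@(frame xa ab bc w size) xq (q≢x ∷ q≢a ∷ q≢b ∷ q≢cs) qa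
        | (b≢a ∷ b≢x ∷ b≢cs) ∷ (a≢x ∷ a≢cs) ∷ _
        | q′ , aq′ , (q′≢x ∷ q′≢a ∷ q′≢b ∷ q′≢cs) | d , ds , G , _ , to , _
        | .b , r≢c , q′b | yes refl with exit-b F
    ... | q″ , bq″ , (q″≢x ∷ q″≢a ∷ q″≢b ∷ q″≢cs) =
      tooLong F
        (fresh▷ (fresh▷ (fresh▷ (fresh▷ (fresh▷ (path-c F)
          xq (q≢x ∷ q≢cs))
          qa (≢-sym q≢a ∷ a≢x ∷ a≢cs))
          aq′ (q′≢a ∷ (λ { refl → asym qa aq′ }) ∷ q′≢x ∷ q′≢cs))
          q′b (≢-sym q′≢b ∷ b≢a ∷ ≢-sym q≢b ∷ b≢x ∷ b≢cs))
          bq″ (q″≢b ∷ (λ { refl → asym q′b bq″ }) ∷ q″≢a ∷ (λ { refl → noTriangle ab bq″ qa })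
               ∷ q″≢x ∷ q″≢cs))
        ≤-refl

    exit² : ∀ {x a b c cs q} → Frame x a b c cs → R x q → Off (x ∷ a ∷ b ∷ cs) q →
            ∃ λ r → R q r × Off (x ∷ a ∷ b ∷ cs) r
    exit² {b = b} F xq off with other xq b
    ... | r , r≢b , qr =
      r , qr , two-steps-off F xq qr (λ { refl → exit-not-to-a F xq off qr }) r≢b

    -- An out-neighbour `s` of `r` off the cycle would make `a → ⋯ → x → q → r → s` too long. Among
    -- `cs`, three steps from `x` reach only `c`, which is avoided, and `s = a` would allow
    -- `b → ⋯ → x → q → r → a → q₁`. Only `s = b` is left.
    exit²-to-b : ∀ {x a b c cs q r} → Frame x a b c cs → R x q → Off (x ∷ a ∷ b ∷ cs) q →
                 R q r → Off (x ∷ a ∷ b ∷ cs) r → R r b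
    exit²-to-b {x} {a} {b} {c} {cs} {q} {r} F@(frame xa ab bc w size) xq (q≢x ∷ q≢a ∷ q≢b ∷ q≢cs)
               qr (r≢x ∷ r≢a ∷ r≢b ∷ r≢cs)
      with other qr c
    ... | s , s≢c , rs with s ≟ᵛ b
    ... | yes refl = rs
    ... | no s≢b = contradiction (+-monoʳ-≤ 3 two) (tooLong F
        (fresh▷ (fresh▷ (fresh▷ (path-a F)
          xq (q≢x ∷ Allₚ.++⁺ q≢cs (q≢b ∷ q≢a ∷ [])))
          qr (≢-sym (R⇒≢ qr) ∷ r≢x ∷ Allₚ.++⁺ r≢cs (r≢b ∷ r≢a ∷ [])))
          rs (≢-sym (R⇒≢ rs) ∷ (λ { refl → asym qr rs }) ∷ (λ { refl → noTriangle xq qr rs })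
              ∷ Allₚ.++⁺ s≢cs (s≢b ∷ s≢a ∷ []))))
      where
      two : 2 + length cs ≤ length (cs ++ b ∷ a ∷ [])
      two = ≤-reflexive (sym (trans (length-++ cs) (+-comm (length cs) 2)))
      s≢cs : All (s ≢_) cs
      s≢cs with s ∈ˡ? cs
      ... | no  s∉ = Allₚ.¬Any⇒All¬ cs s∉
      ... | yes s∈ = contradiction (proj₂ (reach-cs F (stop ▷ xq ▷ qr ▷ rs) s∈ ≤-refl)) s≢c
      s≢a : s ≢ a
      s≢a refl with unique-abx F | exit-a F
      ... | (b≢a ∷ b≢x ∷ b≢cs) ∷ (a≢x ∷ a≢cs) ∷ _ | q₁ , aq₁ , (q₁≢x ∷ q₁≢a ∷ q₁≢b ∷ q₁≢cs) =
        tooLong F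
          (fresh▷ (fresh▷ (fresh▷ (fresh▷ (path-b F)
            xq (q≢x ∷ Allₚ.∷ʳ⁺ q≢cs q≢b))
            qr (≢-sym (R⇒≢ qr) ∷ r≢x ∷ Allₚ.∷ʳ⁺ r≢cs r≢b))
            rs (≢-sym r≢a ∷ ≢-sym q≢a ∷ a≢x ∷ Allₚ.∷ʳ⁺ a≢cs (≢-sym b≢a)))
            aq₁ (q₁≢a ∷ (λ { refl → asym rs aq₁ }) ∷ (λ { refl → noTriangle qr rs aq₁ })
                 ∷ q₁≢x ∷ Allₚ.∷ʳ⁺ q₁≢cs q₁≢b))
          (+-monoʳ-≤ 4 (length-∷ʳ cs b))

    -- The detour `x → q → r → b` bypasses `a`, and a second one `b → q₂ → r₂ → d` bypasses `c`. If
    -- they do not meet in `r₂ = q`, the path `c → ⋯ → x → q → r → b → q₂ → r₂` is too long; if they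
    -- do, then `x → q → d` reaches the cycle too early.
    noFrame : ∀ {x a b c cs} → ¬ Frame x a b c cs
    noFrame {x} {a} {b} {c} {cs} F with unique-abx F | exit F | rotate F
    ... | (b≢a ∷ b≢x ∷ b≢cs) ∷ _ | q , xq , offq@(q≢x ∷ q≢a ∷ q≢b ∷ q≢cs) | d , ds , G , d∈ , to , from
      with exit² F xq offq | rotate G
    ... | r , qr , offr@(r≢x ∷ r≢a ∷ r≢b ∷ r≢cs) | e , es , H , _ , to′ , from′
      with exit²-to-b F xq offq qr offr | exit H
    ... | rb | q₂ , bq₂ , offq₂ with exit² H bq₂ offq₂ | to (to′ offq₂)
    ... | r₂ , q₂r₂ , offr₂ | (q₂≢x ∷ q₂≢a ∷ q₂≢b ∷ q₂≢cs) with r₂ ≟ᵛ q | to (to′ offr₂)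
    ... | no r₂≢q | (r₂≢x ∷ r₂≢a ∷ r₂≢b ∷ r₂≢cs) =
      tooLong F
        (fresh▷ (fresh▷ (fresh▷ (fresh▷ (fresh▷ (path-c F)
          xq (q≢x ∷ q≢cs))
          qr (≢-sym (R⇒≢ qr) ∷ r≢x ∷ r≢cs))
          rb (≢-sym r≢b ∷ ≢-sym q≢b ∷ b≢x ∷ b≢cs))
          bq₂ (q₂≢b ∷ (λ { refl → asym rb bq₂ }) ∷ (λ { refl → noTriangle qr rb bq₂ }) ∷ q₂≢x ∷ q₂≢cs))
          q₂r₂ (≢-sym (R⇒≢ q₂r₂) ∷ r₂≢b ∷ (λ { refl → noTriangle rb bq₂ q₂r₂ }) ∷ r₂≢q ∷ r₂≢x ∷ r₂≢cs))
        ≤-refl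
    ... | yes refl | _ with exit²-to-b H bq₂ offq₂ q₂r₂ offr₂ | d∈
    ... | qd | here refl = asym xq qd
    ... | qd | there d∈cs =
      contradiction (proj₁ (reach-cs F (stop ▷ xq ▷ qd) d∈cs (n≤1+n _))) (<⇒≱ ≤-refl)

    noClosedWalk : ∀ {x ys y} → Walk R x ys y → R y x → suc (length ys) ≢ ℓ
    noClosedWalk stop              r _    = asym r r
    noClosedWalk (stop ▷ a)        r _    = asym a r
    noClosedWalk (stop ▷ a ▷ b)    r _    = noTriangle a b r
    noClosedWalk {ys = _ ∷ _ ∷ _ ∷ ys} (p ▷ a ▷ b ▷ c) r size =
      noFrame (frame a b c (stop ▷ r ▷▷ p)
        (trans (cong (3 +_) (trans (length-++ ys) (+-comm (length ys) 1))) size))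

  walk-of-length : ∀ {x y} → R x y → ∀ n → ∃₂ λ ys z → Walk R y ys z × length ys ≡ n × (∃ λ w → R w z)
  walk-of-length r zero    = [] , _ , stop , refl , _ , r
  walk-of-length r (suc n) with walk-of-length r n
  ... | ys , z , p , refl , _ , wz with other wz z
  ... | u , _ , zu = _ , u , (p ▷ zu) , refl , z , zu

  -- A cycle of length `g` has `k ≤ g + 3`, so the rerouted path would be too long. Hence all girth
  -- bounds hold by induction, and a walk with `k` arcs is a path with too many vertices.
  noArc-triangleFree : ∀ k → (∀ {x y z} → R x y → R y z → ¬ R z x) →
    (∀ {x ys y} → Walk R x ys y → R y x → k ≤ 4 + length ys) →
    (∀ {x ys y} → Path R x ys y → suc (length ys) < k) →
    ∀ {x y} → ¬ R x y
  noArc-triangleFree k noTriangle girth noLongPath r with walk-of-length r k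
  ... | ys , z , p , refl , _ =
    <⇒≱ (noLongPath (acyclic-walk-path _≟ᵛ_ acyclic p)) (n≤1+n _)
    where
    noClosedWalk≤ : ∀ g → Girth≥ R g
    noClosedWalk≤ zero    _ _ = z≤n
    noClosedWalk≤ (suc g) = Girth≥-suc _≟ᵛ_ (noClosedWalk≤ g) λ (q , _) s size →
      ShortestClosedWalk.noClosedWalk noTriangle g (noClosedWalk≤ g)
        (λ q′ → ≤-pred (≤-trans (noLongPath q′)
           (≤-trans (girth q s) (≤-reflexive (cong (3 +_) size))))) q s size
    acyclic : ∀ {x ys y} → Walk R x ys y → ¬ R y x
    acyclic q s = <-irrefl refl (noClosedWalk≤ _ q s)

  -- The case without paths on six vertices

  -- Asymmetry already separates consecutive vertices, so only the diagonals are required to be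
  -- distinct.
  record Cycle₄ (a b c d : V) : Set where
    constructor cycle₄
    field
      ab : R a b
      bc : R b c
      cd : R c d
      da : R d a
      a≢c : a ≢ c
      b≢d : b ≢ d

  record Cycle₅ (a b c d e : V) : Set where
    constructor cycle₅
    field
      ab : R a b
      bc : R b c
      cd : R c d
      de : R d e
      ea : R e a
      a≢c : a ≢ c
      b≢d : b ≢ d
      c≢e : c ≢ e
      d≢a : d ≢ a
      e≢b : e ≢ b

  -- The regular tournament on the integers modulo five: every vertex beats the next two.
  record Tournament₅ (a b c d e : V) : Set where
    constructor tournament₅
    field
      ab : R a b
      bc : R b c
      cd : R c d
      de : R d e
      ea : R e a
      ac : R a c
      bd : R b d
      ce : R c e
      da : R d a
      eb : R e b

  rotate-tournament₅ : ∀ {a b c d e} → Tournament₅ a b c d e → Tournament₅ b c d e a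
  rotate-tournament₅ (tournament₅ ab bc cd de ea ac bd ce da eb) =
    tournament₅ bc cd de ea ab bd ce da eb ac

  distinct-tournament₅ : ∀ {a b c d e} → Tournament₅ a b c d e → Unique (a ∷ b ∷ c ∷ d ∷ e ∷ [])
  distinct-tournament₅ (tournament₅ ab bc cd de ea ac bd ce da eb) =
    (R⇒≢ ab ∷ R⇒≢ ac ∷ ≢-sym (R⇒≢ da) ∷ ≢-sym (R⇒≢ ea) ∷ []) ∷
    (R⇒≢ bc ∷ R⇒≢ bd ∷ ≢-sym (R⇒≢ eb) ∷ []) ∷ (R⇒≢ cd ∷ R⇒≢ ce ∷ []) ∷ (R⇒≢ de ∷ []) ∷ [] ∷ []

  module NoSixVertexPath (noLongPath : ∀ {x ys y} → Path R x ys y → length ys < 5) where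

    no6 : ∀ {a b c d e f} → R a b → R b c → R c d → R d e → R e f →
          Unique (f ∷ e ∷ d ∷ c ∷ b ∷ a ∷ []) → ⊥
    no6 ab bc cd de ef u = <-irrefl refl (noLongPath (stop ▷ ab ▷ bc ▷ cd ▷ de ▷ ef , u))

    -- Otherwise `b → c → d → e → a → z` is a path on six vertices.
    chord₅ : ∀ {a b c d e z} → Cycle₅ a b c d e → R a z → z ≢ b → z ≡ c ⊎ z ≡ d
    chord₅ {a} {b} {c} {d} {e} {z} (cycle₅ ab bc cd de ea a≢c b≢d c≢e d≢a e≢b) az z≢b
      with z ≟ᵛ c | z ≟ᵛ d
    ... | yes p  | _      = inj₁ p
    ... | no _   | yes p  = inj₂ p
    ... | no z≢c | no z≢d = ⊥-elim (no6 bc cd de ea az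
      ( (≢-sym (R⇒≢ az) ∷ (λ { refl → asym ea az }) ∷ z≢d ∷ z≢c ∷ z≢b ∷ [])
      ∷ (≢-sym (R⇒≢ ea) ∷ ≢-sym d≢a ∷ a≢c ∷ R⇒≢ ab ∷ [])
      ∷ (≢-sym (R⇒≢ de) ∷ ≢-sym c≢e ∷ e≢b ∷ [])
      ∷ (≢-sym (R⇒≢ cd) ∷ ≢-sym b≢d ∷ []) ∷ (≢-sym (R⇒≢ bc) ∷ []) ∷ [] ∷ []))

    outs-tournament₅ : ∀ {a b c d e z} → Tournament₅ a b c d e → R a z → z ≡ b ⊎ z ≡ c
    outs-tournament₅ {b = b} {z = z} (tournament₅ ab bc cd de ea ac bd ce da eb) az with z ≟ᵛ b
    ... | yes p  = inj₁ p
    ... | no z≢b with chord₅ (cycle₅ ab bc cd de ea (R⇒≢ ac) (R⇒≢ bd) (R⇒≢ ce) (R⇒≢ da) (R⇒≢ eb)) az z≢b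
    ... | inj₁ p    = inj₂ p
    ... | inj₂ refl = contradiction az (asym da)

    -- Excluding five-cycles and four-cycles

    module _ (noTournament₅ : ∀ {a b c d e} → ¬ Tournament₅ a b c d e) where

      chord : ∀ {a b c d e} → Cycle₅ a b c d e → R a c ⊎ R a d
      chord {a} {b} C with other (Cycle₅.ea C) b
      ... | z , z≢b , az with chord₅ C az z≢b
      ... | inj₁ refl = inj₁ az
      ... | inj₂ refl = inj₂ az

      -- In the order `a, c, e, b, d` each chord points to the next or to the previous vertex.
      -- Neighbouring choices that face each other would be a digon, so all chords turn the same
      -- way, and the cycle with its chords is a regular tournament.
      noCycle₅ : ∀ {a b c d e} → ¬ Cycle₅ a b c d e
      noCycle₅ (cycle₅ ab bc cd de ea a≢c b≢d c≢e d≢a e≢b)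
        with chord (cycle₅ ab bc cd de ea a≢c b≢d c≢e d≢a e≢b)
           | chord (cycle₅ cd de ea ab bc c≢e d≢a e≢b a≢c b≢d)
           | chord (cycle₅ ea ab bc cd de e≢b a≢c b≢d c≢e d≢a)
           | chord (cycle₅ bc cd de ea ab b≢d c≢e d≢a e≢b a≢c)
           | chord (cycle₅ de ea ab bc cd d≢a e≢b a≢c b≢d c≢e)
      ... | inj₁ ac | inj₂ ca | _       | _       | _       = asym ac ca
      ... | _       | inj₁ ce | inj₂ ec | _       | _       = asym ce ec
      ... | _       | _       | inj₁ eb | inj₂ be | _       = asym eb be
      ... | _       | _       | _       | inj₁ bd | inj₂ db = asym bd db
      ... | inj₂ ad | _       | _       | _       | inj₁ da = asym ad da
      ... | inj₁ ac | inj₁ ce | inj₁ eb | inj₁ bd | inj₁ da =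
        noTournament₅ (tournament₅ ab bc cd de ea ac bd ce da eb)
      ... | inj₂ ad | inj₂ ca | inj₂ ec | inj₂ be | inj₂ db =
        noTournament₅ (tournament₅ ad db be ec ca ab de bc ea cd)

      Ear : (a b c d q : V) → Set
      Ear a b c d q = All (q ≢_) (a ∷ b ∷ c ∷ d ∷ []) × R a q × R q c × R q d

      -- For `z = b` there is the five-cycle `a → q → b → c → d → a`; otherwise
      -- `b → c → d → a → q → z` has six vertices.
      ear-arc : ∀ {a b c d q z} → Cycle₄ a b c d → R a q → All (q ≢_) (a ∷ b ∷ c ∷ d ∷ []) →
                R q z → z ≡ c ⊎ z ≡ d
      ear-arc {a} {b} {c} {d} {q} {z} (cycle₄ ab bc cd da a≢c b≢d) aq (q≢a ∷ q≢b ∷ q≢c ∷ q≢d ∷ []) qz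
        with z ≟ᵛ b | z ≟ᵛ c | z ≟ᵛ d
      ... | _        | yes p  | _      = inj₁ p
      ... | _        | no _   | yes p  = inj₂ p
      ... | yes refl | no _   | no _   =
        ⊥-elim (noCycle₅ (cycle₅ aq qz bc cd da (R⇒≢ ab) q≢c b≢d (≢-sym a≢c) (≢-sym q≢d)))
      ... | no z≢b   | no z≢c | no z≢d = ⊥-elim (no6 bc cd da aq qz
        ( (≢-sym (R⇒≢ qz) ∷ (λ { refl → asym aq qz }) ∷ z≢d ∷ z≢c ∷ z≢b ∷ [])
        ∷ (q≢a ∷ q≢d ∷ q≢c ∷ q≢b ∷ [])
        ∷ (≢-sym (R⇒≢ da) ∷ a≢c ∷ R⇒≢ ab ∷ [])
        ∷ (≢-sym (R⇒≢ cd) ∷ ≢-sym b≢d ∷ []) ∷ (≢-sym (R⇒≢ bc) ∷ []) ∷ [] ∷ []))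

      chord-or-ear : ∀ {a b c d} → Cycle₄ a b c d → R a c ⊎ ∃ (Ear a b c d)
      chord-or-ear {a} {b} {c} {d} C@(cycle₄ ab bc cd da a≢c b≢d) with other da b
      ... | q , q≢b , aq with q ≟ᵛ c
      ... | yes refl = inj₁ aq
      ... | no q≢c with other aq d | other aq c
      ... | z , z≢d , qz | z′ , z′≢c , qz′ = inj₂ (q , off , aq , qc , qd)
        where
        off = ≢-sym (R⇒≢ aq) ∷ q≢b ∷ q≢c ∷ (λ { refl → asym da aq }) ∷ []
        qc : R q c
        qc with ear-arc C aq off qz
        ... | inj₁ refl = qz
        ... | inj₂ z≡d  = contradiction z≡d z≢d
        qd : R q d
        qd with ear-arc C aq off qz′
        ... | inj₁ z≡c  = contradiction z≡c z′≢c
        ... | inj₂ refl = qz′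

      -- The chord forbids `c → a`, so `c` has an ear `q`. With an ear `p` at `b` the path
      -- `a → c → q → b → p → d` has six vertices; with the chord `b → d` there is an ear `p` at `d`
      -- and the path `a → c → q → b → d → p`.
      noChord₄ : ∀ {a b c d} → Cycle₄ a b c d → ¬ R a c
      noChord₄ {a} {b} {c} {d} (cycle₄ ab bc cd da a≢c b≢d) ac
        with chord-or-ear (cycle₄ cd da ab bc (≢-sym a≢c) (≢-sym b≢d))
           | chord-or-ear (cycle₄ bc cd da ab b≢d (≢-sym a≢c))
      ... | inj₁ ca | _ = asym ac ca
      ... | inj₂ (q , q≢c ∷ q≢d ∷ q≢a ∷ q≢b ∷ [] , cq , qa , qb)
          | inj₂ (p , p≢b ∷ p≢c ∷ p≢d ∷ p≢a ∷ [] , bp , pd , pa) =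
        no6 ac cq qb bp pd
          ( (≢-sym (R⇒≢ pd) ∷ ≢-sym b≢d ∷ ≢-sym q≢d ∷ ≢-sym (R⇒≢ cd) ∷ R⇒≢ da ∷ [])
          ∷ (p≢b ∷ (λ { refl → asym qb bp }) ∷ p≢c ∷ p≢a ∷ [])
          ∷ (≢-sym q≢b ∷ R⇒≢ bc ∷ ≢-sym (R⇒≢ ab) ∷ [])
          ∷ (q≢c ∷ q≢a ∷ []) ∷ (≢-sym a≢c ∷ []) ∷ [] ∷ [])
      ... | inj₂ (q , q≢c ∷ q≢d ∷ q≢a ∷ q≢b ∷ [] , cq , qa , qb) | inj₁ bd
        with chord-or-ear (cycle₄ da ab bc cd (≢-sym b≢d) a≢c)
      ... | inj₁ db = asym bd db
      ... | inj₂ (p , p≢d ∷ p≢a ∷ p≢b ∷ p≢c ∷ [] , dp , pb , pc) =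
        no6 ac cq qb bd dp
          ( (p≢d ∷ p≢b ∷ (λ { refl → asym cq pc }) ∷ p≢c ∷ p≢a ∷ [])
          ∷ (≢-sym b≢d ∷ ≢-sym q≢d ∷ ≢-sym (R⇒≢ cd) ∷ R⇒≢ da ∷ [])
          ∷ (≢-sym q≢b ∷ R⇒≢ bc ∷ ≢-sym (R⇒≢ ab) ∷ [])
          ∷ (q≢c ∷ q≢a ∷ []) ∷ (≢-sym a≢c ∷ []) ∷ [] ∷ [])

      noCycle₄ : ∀ {a b c d} → ¬ Cycle₄ a b c d
      noCycle₄ {a} {b} {c} {d} C@(cycle₄ ab bc cd da a≢c b≢d)
        with chord-or-ear C | chord-or-ear (cycle₄ cd da ab bc (≢-sym a≢c) (≢-sym b≢d))
      ... | inj₁ ac | _ = noChord₄ C ac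
      ... | inj₂ _  | inj₁ ca = noChord₄ (cycle₄ cd da ab bc (≢-sym a≢c) (≢-sym b≢d)) ca
      ... | inj₂ (q , q≢a ∷ q≢b ∷ q≢c ∷ q≢d ∷ [] , aq , qc , qd)
          | inj₂ (p , p≢c ∷ p≢d ∷ p≢a ∷ p≢b ∷ [] , cp , pa , pb) =
        no6 da aq qc cp pb
          ( (≢-sym (R⇒≢ pb) ∷ R⇒≢ bc ∷ ≢-sym q≢b ∷ ≢-sym (R⇒≢ ab) ∷ b≢d ∷ [])
          ∷ (p≢c ∷ (λ { refl → asym qc cp }) ∷ p≢a ∷ p≢d ∷ [])
          ∷ (≢-sym q≢c ∷ ≢-sym a≢c ∷ R⇒≢ cd ∷ [])
          ∷ (q≢a ∷ q≢d ∷ []) ∷ (≢-sym (R⇒≢ da) ∷ []) ∷ [] ∷ [])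

      -- A walk chosen so as never to close a triangle closes a four-cycle or a five-cycle, or else
      -- visits six vertices.
      noArc-noTournament₅ : ∀ {x a} → ¬ R x a
      noArc-noTournament₅ {x} {a} xa with other xa x
      ... | b , _ , ab with other ab a
      ... | c , c≢a , bc with other bc a
      ... | d , d≢a , cd with other cd b
      ... | e , e≢b , de with e ≟ᵛ a
      ... | yes refl = noCycle₄ (cycle₄ ab bc cd de (≢-sym c≢a) b≢d)
        where
        b≢d : b ≢ d
        b≢d refl = asym bc cd
      ... | no e≢a with other de c
      ... | f , f≢c , ef with f ≟ᵛ a | f ≟ᵛ b
      ... | yes refl | _        =
        noCycle₅ (cycle₅ ab bc cd de ef (≢-sym c≢a)
          (λ { refl → asym bc cd }) (λ { refl → asym cd de }) d≢a e≢b)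
      ... | no _     | yes refl =
        noCycle₄ (cycle₄ bc cd de ef (λ { refl → asym bc cd }) (λ { refl → asym cd de }))
      ... | no f≢a   | no f≢b   = no6 ab bc cd de ef
        ( (≢-sym (R⇒≢ ef) ∷ (λ { refl → asym de ef }) ∷ f≢c ∷ f≢b ∷ f≢a ∷ [])
        ∷ (≢-sym (R⇒≢ de) ∷ (λ { refl → asym cd de }) ∷ e≢b ∷ e≢a ∷ [])
        ∷ (≢-sym (R⇒≢ cd) ∷ (λ { refl → asym bc cd }) ∷ d≢a ∷ [])
        ∷ (≢-sym (R⇒≢ bc) ∷ c≢a ∷ []) ∷ (≢-sym (R⇒≢ ab) ∷ []) ∷ [] ∷ [])

-- Vertices of minimum out-degree in the absence of Seymour vertices

module NoSeymourVertex
  (D : Digraph) (oriented : IsOriented D)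
  (Out Out²     : Digraph.Vertex D → Subset (Digraph.order D))
  (arc⇒∈Out     : ∀ {v u} → Digraph.Arc D v u → u ∈ Out v)
  (∈Out⇒arc     : ∀ {v u} → u ∈ Out v → Digraph.Arc D v u)
  (second⇒∈Out² : ∀ {v x u} → Digraph.Arc D v x → Digraph.Arc D x u → ¬ Digraph.Arc D v u → u ∈ Out² v)
  (∈Out²⇒¬arc   : ∀ {v u} → u ∈ Out² v → ¬ Digraph.Arc D v u)
  (noSeymour    : ∀ v → ∣ Out² v ∣ < ∣ Out v ∣)
  where

  open Digraph D
  open OrientedDigraph D oriented
    using (noLoops; noDigons; arc⇒≢; girth≥3)

  Min : Vertex → Set
  Min v = ∀ u → ∣ Out v ∣ ≤ ∣ Out u ∣

  minimum : Vertex → ∃ Min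
  minimum v = search _ v ≤-refl
    where
    search : ∀ m v → ∣ Out v ∣ ≤ m → ∃ Min
    search m v l with any? (λ u → suc ∣ Out u ∣ ≤? ∣ Out v ∣)
    ... | no none = v , λ u → ≮⇒≥ (λ lt → none (u , lt))
    search zero    v l | yes (u , lt) = contradiction (≤-trans lt l) λ ()
    search (suc m) v l | yes (u , lt) = search m u (≤-pred (≤-trans lt l))

  out : ∀ v → ∃ λ u → Arc v u
  out v with any? (arc? v)
  ... | yes found = found
  ... | no  none  = contradiction
    (p⊆q⇒∣p∣≤∣q∣ {q = Out² v} (λ m → contradiction (_ , ∈Out⇒arc m) none)) (<⇒≱ (noSeymour v))

  out-within : ∀ {v x} → Min v → Arc v x → ∃ λ y → Arc v y × Arc x y
  out-within {v} {x} min vx with any? (λ y → arc? v y ×-dec arc? x y)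
  ... | yes found = found
  ... | no  none  = contradiction
    (≤-trans (min x) (p⊆q⇒∣p∣≤∣q∣ λ {y} m →
      second⇒∈Out² vx (∈Out⇒arc m) (λ vy → none (y , vy , ∈Out⇒arc m))))
    (<⇒≱ (noSeymour v))

  -- Otherwise N⁺(x) is contained in N⁺(v) without `x`, which is smaller than the minimum
  -- out-degree.
  out-Out² : ∀ {v x} → Min v → Arc v x → ∃ λ w → w ∈ Out² v × Arc x w
  out-Out² {v} {x} min vx with any? (λ w → (w ∈? Out² v) ×-dec arc? x w)
  ... | yes found = found
  ... | no  none  = contradiction
    (≤-trans (min x) (p⊆q⇒∣p∣≤∣q∣ λ {y} m →
      x∈p∧x≢y⇒x∈p-y (inside m) (≢-sym (arc⇒≢ (∈Out⇒arc m)))))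
    (<⇒≱ (x∈p⇒∣p-x∣<∣p∣ (arc⇒∈Out vx)))
    where
    inside : ∀ {y} → y ∈ Out x → y ∈ Out v
    inside {y} m with arc? v y
    ... | yes vy = arc⇒∈Out vy
    ... | no ¬vy = contradiction (y , second⇒∈Out² vx (∈Out⇒arc m) ¬vy , ∈Out⇒arc m) none

  module _ {v x p} (min : Min v) (vx : Arc v x) (only : ∀ {y} → Arc v y → Arc x y → y ≡ p) where

    outside : ∀ {y} → y ∈ Out x → y ≢ p → y ∈ Out² v
    outside m y≢p = second⇒∈Out² vx (∈Out⇒arc m) (λ vy → y≢p (only vy (∈Out⇒arc m)))

    -- N⁺(x) lies in N⁺⁺(v) together with `p`, hence has at most `∣ Out v ∣` elements.
    sole-out⇒min : Min x
    sole-out⇒min u = ≤-trans (p⊆⁅x⁆∪q⇒∣p∣≤1+∣q∣ p outside) (≤-trans (noSeymour v) (min u))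

    -- The count in `sole-out⇒min` is tight: missing a single `w` would push the out-degree of `x`
    -- below the minimum.
    sole-out⇒dominates : ∀ {w} → w ∈ Out² v → Arc x w
    sole-out⇒dominates {w} m with arc? x w
    ... | yes xw = xw
    ... | no ¬xw = contradiction
      (≤-trans (min x) (≤-trans
        (p⊆⁅x⁆∪q⇒∣p∣≤1+∣q∣ {q = Out² v - w} p λ y∈ y≢p →
          x∈p∧x≢y⇒x∈p-y (outside y∈ y≢p) (λ { refl → ¬xw (∈Out⇒arc y∈) }))
        (x∈p⇒∣p-x∣<∣p∣ m)))
      (<⇒≱ (noSeymour v))

  -- p is the only out-neighbour of s in N⁺(v), which forces N⁺(s) = {p} ∪ N⁺⁺(v).
  record Good (p v s : Vertex) : Set where
    constructor good
    field
      min  : Min v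
      vs   : Arc v s
      vp   : Arc v p
      sp   : Arc s p
      only : ∀ {y} → Arc v y → Arc s y → y ≡ p

    s-min : Min s
    s-min = sole-out⇒min min vs only

    dominates : ∀ {w} → w ∈ Out² v → Arc s w
    dominates = sole-out⇒dominates min vs only

  Within : (Vertex → Set) → Rel Vertex 0ℓ
  Within P x y = P x × Arc x y × P y

  Serial : (Vertex → Set) → Set
  Serial P = ∀ {x} → P x → ∃ λ y → P y × Arc x y

  within-walk : ∀ {P x} → Serial P → P x → ∀ n →
                ∃₂ λ ys y → Walk (Within P) x ys y × P y × length ys ≡ n
  within-walk next Px zero    = [] , _ , stop , Px , refl
  within-walk next Px (suc n) with within-walk next Px n
  ... | ys , y , p , Py , refl with next Py
  ... | z , Pz , yz = y ∷ ys , z , (p ▷ (Py , yz , Pz)) , Pz , refl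

  short-path : ∀ {g P x ys y} → Girth≥ Arc g → Walk (Within P) x ys y → length ys < g → Path Arc x ys y
  short-path girth p = short-walk-path _≟_ girth (map-walk (proj₁ ∘ proj₂) p)

  -- Good arcs and forbidden paths through N⁺⁺(v)

  module AntiTransitiveFree
    (k : ℕ) (1≤k : 1 ≤ k)
    (antiTransitive : ∀ {x ys y} → Path Arc x ys y → length ys ≡ k → ¬ Arc x y)
    (girth≥k-3 : ∀ {x ys y} → Walk Arc x ys y → Arc y x → k ≤ 4 + length ys)
    where

    girth≥ : ∀ {g} → 3 + g ≤ k → Girth≥ Arc g
    girth≥ l p r = +-cancelˡ-≤ 3 _ _ (≤-trans l (girth≥k-3 p r))

    -- As `s` dominates N⁺⁺(v), the combined path ends in an out-neighbour of its start `s`.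
    through-Out² : ∀ {p v s ys t w zs w′} → Good p v s →
                   Path Arc s ys t → All (Arc v) (t ∷ ys) → Arc t w →
                   Path Arc w zs w′ → All (_∈ Out² v) (w′ ∷ zs) →
                   length zs + suc (length ys) ≢ k
    through-Out² {zs = zs} G path in-Out tw path′ all@(w′∈ ∷ _) size =
      antiTransitive (path-join path in-Out tw path′ (All.map ∈Out²⇒¬arc all))
        (trans (length-++ zs) size) (Good.dominates G w′∈)

    within-all : ∀ {P x ys y} → Walk (Within P) x ys y → P y → All P (y ∷ ys)
    within-all p Py = Py ∷ all-sources proj₁ p

    two-short-paths : ∀ {p v s g} i j → Good p v s → Serial (_∈ Out² v) → Girth≥ Arc g →
                      i < g → j < g → j + suc i ≢ k
    two-short-paths i j G serial girth i<g j<g size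
      with within-walk (out-within (Good.min G)) (Good.vs G) i
    ... | ys , t , walk , vt , refl with out-Out² (Good.min G) vt
    ... | w , w∈ , tw with within-walk serial w∈ j
    ... | zs , w′ , walk′ , w′∈ , refl =
      through-Out² G (short-path girth walk i<g) (within-all walk vt)
        tw (short-path girth walk′ j<g) (within-all walk′ w′∈) size

    -- Longer paths are built by hand. They force `s` to be the only out-neighbour of `b` in N⁺(v),
    -- so `b` dominates N⁺⁺(v), and force `w → w′ → w″ → w` to be a triangle. Then `w` dominates
    -- N⁺⁺(s), which contains `b`, against `b → w`.
    Out²-not-serial-6 : ∀ {p v s} → k ≡ 6 → Good p v s → ¬ Serial (_∈ Out² v)
    Out²-not-serial-6 {p} {v} {s} k≡6 G@(good min vs vp sp only) serial
      with out-within min vp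
    ... | b , vb , pb with out-Out² min vp
    ... | w , w∈ , pw with serial w∈
    ... | w′ , w′∈ , ww′ with serial w′∈
    ... | w″ , w″∈ , w′w″ = noDigons (sole-out⇒dominates s-min (dominates w∈) only-w′ b∈) (b-dominates w∈)
      where
      open Good G using (s-min; dominates)
      to-s : ∀ {c} → Arc v c → Arc b c → c ≡ s
      to-s {c} vc bc with c ≟ s
      ... | yes c≡s = c≡s
      ... | no  c≢s with out-Out² min vc
      ... | u , u∈ , cu with within-walk serial u∈ 2
      ... | zs , u′ , walk , u′∈ , len = contradiction (trans (cong (_+ 4) len) (sym k≡6))
        (through-Out² G
          (fresh▷ (short-walk-path _≟_ girth≥3 (stop ▷ sp ▷ pb) ≤-refl) bc
            (≢-sym (arc⇒≢ bc) ∷ (λ { refl → noDigons pb bc }) ∷ c≢s ∷ []))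
          (vc ∷ vb ∷ vp ∷ vs ∷ []) cu
          (short-path girth≥3 walk (≤-reflexive (cong suc len))) (within-all walk u′∈))
      b-dominates : ∀ {u} → u ∈ Out² v → Arc b u
      b-dominates = sole-out⇒dominates min vb to-s
      returns : ∀ {x y z u} → x ∈ Out² v → y ∈ Out² v → z ∈ Out² v → u ∈ Out² v →
                Arc x y → Arc y z → Arc z u → u ≡ x
      returns {x} {y} {z} {u} x∈ y∈ z∈ u∈ xy yz zu with u ≟ x
      ... | yes u≡x = u≡x
      ... | no  u≢x = contradiction (sym k≡6)
        (through-Out² G (short-walk-path _≟_ girth≥3 (stop ▷ sp ▷ pb) ≤-refl) (vb ∷ vp ∷ vs ∷ [])
          (b-dominates x∈)
          (fresh▷ (short-walk-path _≟_ girth≥3 (stop ▷ xy ▷ yz) ≤-refl) zu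
            (≢-sym (arc⇒≢ zu) ∷ (λ { refl → noDigons yz zu }) ∷ u≢x ∷ []))
          (u∈ ∷ z∈ ∷ y∈ ∷ x∈ ∷ []))
      w″w : Arc w″ w
      w″w with serial w″∈
      ... | u , u∈ , w″u = subst (Arc w″) (returns w∈ w′∈ w″∈ u∈ ww′ w′w″ w″u) w″u
      only-w′ : ∀ {y} → Arc s y → Arc w y → y ≡ w′
      only-w′ {y} sy wy with arc? v y
      ... | yes vy = contradiction (subst (Arc w) (only vy sy) wy) (noDigons pw)
      ... | no ¬vy = returns w′∈ w″∈ w∈ (second⇒∈Out² vs sy ¬vy) w′w″ w″w wy
      b∈ : b ∈ Out² s
      b∈ = second⇒∈Out² sp pb (λ sb → noLoops (subst (Arc p) (only vb sb) pb))

    -- k - 1 splits into two parts below the girth bound max(3, k - 3) unless k = 6.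
    Out²-not-serial : ∀ {p v s} → Good p v s → ¬ Serial (_∈ Out² v)
    Out²-not-serial G serial = by-k k refl
      where
      by-k : ∀ m → m ≡ k → ⊥
      by-k 0 eq = contradiction (subst (1 ≤_) (sym eq) 1≤k) λ ()
      by-k 1 eq = two-short-paths 0 0 G serial girth≥3 (s≤s z≤n) (s≤s z≤n) eq
      by-k 2 eq = two-short-paths 1 0 G serial girth≥3 (s≤s (s≤s z≤n)) (s≤s z≤n) eq
      by-k 3 eq = two-short-paths 2 0 G serial girth≥3 ≤-refl (s≤s z≤n) eq
      by-k 4 eq = two-short-paths 2 1 G serial girth≥3 ≤-refl (s≤s (s≤s z≤n)) eq
      by-k 5 eq = two-short-paths 2 2 G serial girth≥3 ≤-refl ≤-refl eq
      by-k 6 eq = Out²-not-serial-6 (sym eq) G serial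
      by-k (suc (suc (suc (suc (suc (suc (suc m))))))) eq =
        two-short-paths 3 (3 + m) G serial (girth≥ {4 + m} (≤-reflexive eq)) (m≤m+n 4 m) ≤-refl
          (trans (cong (3 +_) (+-comm m 4)) eq)

    -- A sink `w` of N⁺⁺(v) can have only `p` as an out-neighbour in N⁺(s), which consists of `p`
    -- and N⁺⁺(v).
    good-next : ∀ {p v s} → Good p v s → ∃ λ w → Good p s w
    good-next {p} {v} {s} G@(good min vs vp sp only)
      with any? (λ w → (w ∈? Out² v) ×-dec ¬? (any? (λ u → (u ∈? Out² v) ×-dec arc? w u)))
    ... | no  none = ⊥-elim (Out²-not-serial G serial)
      where
      serial : Serial (_∈ Out² v)
      serial {w} w∈ with any? (λ u → (u ∈? Out² v) ×-dec arc? w u)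
      ... | yes found = found
      ... | no  sink  = contradiction (w , w∈ , sink) none
    ... | yes (w , w∈ , sink) = w , good s-min (dominates w∈) sp wp only-p
      where
      open Good G using (s-min; dominates)
      only-p : ∀ {y} → Arc s y → Arc w y → y ≡ p
      only-p {y} sy wy with arc? v y
      ... | yes vy = only vy sy
      ... | no ¬vy = contradiction (y , second⇒∈Out² vs sy ¬vy , wy) sink
      wp : Arc w p
      wp with out-within s-min (dominates w∈)
      ... | y , sy , wy = subst (Arc w) (only-p sy wy) wy

    -- Walks of good arcs with a common target

    module SoleTarget (p : Vertex) where

      arcs : ∀ {x ys y} → Walk (Good p) x ys y → Walk Arc x ys y
      arcs = map-walk Good.vs

      end→p : ∀ {x ys y} → Walk (Good p) x ys y → Arc x p → Arc y p
      end→p stop    xp = xp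
      end→p (_ ▷ G) _  = Good.sp G

      all→p : ∀ {x ys y} → Walk (Good p) x ys y → Arc x p → All (λ a → Arc a p) (y ∷ ys)
      all→p walk xp = end→p walk xp ∷ all-sources Good.vp walk

      off-in : ∀ {z q ys} → All (λ a → Arc a q) ys → ¬ Arc z q → All (z ≢_) ys
      off-in ins ¬zq = All.map (λ { aq refl → ¬zq aq }) ins

      to-p : ∀ {x ys y} → Path (Good p) x ys y → Arc x p → Path Arc x (y ∷ ys) p
      to-p (walk , u) xp = fresh▷ (arcs walk , u) (end→p walk xp) (off-in (all→p walk xp) noLoops)

      to-p-z : ∀ {x ys y z} → Path (Good p) x ys y → Arc x p → Arc p z → Path Arc x (p ∷ y ∷ ys) z
      to-p-z path@(walk , u) xp pz = fresh▷ (to-p path xp) pz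
        (≢-sym (arc⇒≢ pz) ∷ off-in (all→p walk xp) (noDigons pz))

      -- A longer path, cut after `k - 1` arcs and continued to `p`, would have length `k` and join
      -- `x` to its out-neighbour `p`.
      good-path-length : ∀ {x ys y} → Path (Good p) x ys y → Arc x p → suc (length ys) < k
      good-path-length {ys = ys} path xp with suc (suc (length ys)) ≤? k
      ... | yes l = l
      ... | no ¬l with initial (k ∸ 1) (∸-monoˡ-≤ 1 (≤-pred (≰⇒> ¬l))) path
      ... | zs , z , path′ , len =
        contradiction xp (antiTransitive (to-p path′ xp) (trans (cong suc len) (m+[n∸m]≡n 1≤k)))

      -- An out-neighbour of p is an out-neighbour of exactly one of two consecutive
      -- vertices of a Good p walk.
      sides-differ : ∀ {x y z} → Good p x y → Arc p z → Arc x z → ¬ Arc y z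
      sides-differ G pz xz yz = noLoops (subst (Arc p) (Good.only G xz yz) pz)

      sides-cover : ∀ {x y z} → Good p x y → Arc p z → ¬ Arc x z → Arc y z
      sides-cover G pz ¬xz = Good.dominates G (second⇒∈Out² (Good.vp G) pz ¬xz)

      same-side : ∀ {w x y z} → Good p w x → Good p x y → Arc p z → Arc w z → Arc y z
      same-side G H pz wz = sides-cover H pz (sides-differ G pz wz)

      -- Being an in-neighbour of a fixed out-neighbour of `p` alternates along good arcs, which is
      -- impossible on an odd cycle.
      no-triangle : ∀ {x y z} → Good p x y → Good p y z → ¬ Good p z x
      no-triangle {x} F G H with out p
      ... | w , pw with arc? x w
      ... | yes xw = sides-differ H pw (same-side F G pw xw) xw
      ... | no ¬xw = sides-differ G pw (sides-cover F pw ¬xw)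
        (sides-cover G pw λ yw → ¬xw (same-side G H pw yw))

      no-shortcut : ∀ {x y z} → Good p x y → Good p y z → ¬ Arc x z
      no-shortcut G H xz = noLoops (subst (λ w → Arc w p) (Good.only G xz (Good.vs H)) (Good.sp H))

      -- If `z` were the only common out-neighbour of `x` and `p`, then `p` would dominate N⁺⁺(x)
      -- and hence `y′`, against `y′ → p`.
      another-on-side : ∀ {x y y′} → Good p x y → Good p y y′ → ∀ z → ∃ λ z′ → z′ ≢ z × Arc x z′ × Arc p z′
      another-on-side {x} {y} {y′} G H z
        with any? (λ z′ → ¬? (z′ ≟ z) ×-dec arc? x z′ ×-dec arc? p z′)
      ... | yes found = found
      ... | no  none  = contradiction (Good.sp H) (noDigons
        (sole-out⇒dominates (Good.min G) (Good.vp G) only-z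
          (second⇒∈Out² (Good.vs G) (Good.vs H) (no-shortcut G H))))
        where
        only-z : ∀ {w} → Arc x w → Arc p w → w ≡ z
        only-z {w} xw pw with w ≟ z
        ... | yes w≡z = w≡z
        ... | no  w≢z = contradiction (w , w≢z , xw , pw) none

      module Cycle {x ys y} (walk : Walk (Good p) x ys y) (u : Unique (y ∷ ys)) (G : Good p y x) where

        xp : Arc x p
        xp = Good.sp G

        x-min : Min x
        x-min = Good.s-min G

        -- The path runs around the cycle from `x`, then to `p` and to a common out-neighbour `z` of
        -- `x` and `p`.
        k≢2+ : k ≢ 2 + length ys
        k≢2+ k≡ with out-within x-min xp
        ... | z , xz , pz = antiTransitive (to-p-z (walk , u) xp pz) (sym k≡) xz

        -- One more step inside N⁺(x). The new vertex is off the cycle, all of whose vertices have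
        -- arcs to `p`, since `z′ → p` would close a triangle.
        k≢3+ : Girth≥ Arc 4 → k ≢ 3 + length ys
        k≢3+ girth k≡ with out-within x-min xp
        ... | z , xz , pz with out-within x-min xz
        ... | z′ , xz′ , zz′ = antiTransitive
          (fresh▷ (to-p-z (walk , u) xp pz) zz′
            (≢-sym (arc⇒≢ zz′) ∷ (λ { refl → noDigons pz zz′ }) ∷
             off-in (all→p walk xp) (λ z′p → contradiction (girth (stop ▷ pz ▷ zz′) z′p) (<⇒≱ ≤-refl))))
          (sym k≡) xz′

        k≢4+ : Girth≥ Arc 5 → k ≢ 4 + length ys
        k≢4+ girth k≡ with out-within x-min xp
        ... | z , xz , pz with out-within x-min xz
        ... | z′ , xz′ , zz′ with out-within x-min xz′
        ... | z″ , xz″ , z′z″ = antiTransitive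
          (fresh▷ (fresh▷ (to-p-z (walk , u) xp pz) zz′
            (≢-sym (arc⇒≢ zz′) ∷ (λ { refl → noDigons pz zz′ }) ∷
             off-in (all→p walk xp) (λ z′p → contradiction (girth (stop ▷ pz ▷ zz′) z′p) (<⇒≱ (n≤1+n _)))))
            z′z″
            (≢-sym (arc⇒≢ z′z″) ∷ (λ { refl → noDigons zz′ z′z″ }) ∷
             (λ { refl → contradiction (girth (stop ▷ pz ▷ zz′) z′z″) (<⇒≱ (n≤1+n _)) }) ∷
             off-in (all→p walk xp) (λ z″p → contradiction (girth (stop ▷ pz ▷ zz′ ▷ z′z″) z″p) (<⇒≱ ≤-refl))))
          (sym k≡) xz″

      -- Four-cycles of good arcs

      module _ {a b c d} (F : Good p a b) (G : Good p b c) (H : Good p c d) (I : Good p d a) where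

        ac-distinct : a ≢ c
        ac-distinct refl = noDigons (Good.vs F) (Good.vs G)

        bd-distinct : b ≢ d
        bd-distinct refl = noDigons (Good.vs G) (Good.vs H)

        square : Path (Good p) a (c ∷ b ∷ a ∷ []) d
        square = (stop ▷ F ▷ G ▷ H) ,
          (≢-sym (arc⇒≢ (Good.vs H)) ∷ ≢-sym bd-distinct ∷ arc⇒≢ (Good.vs I) ∷ []) ∷
          (≢-sym (arc⇒≢ (Good.vs G)) ∷ ≢-sym ac-distinct ∷ []) ∷ (≢-sym (arc⇒≢ (Good.vs F)) ∷ []) ∷ [] ∷ []

        off-square : ∀ {z} → Arc p z → All (z ≢_) (d ∷ c ∷ b ∷ a ∷ [])
        off-square pz = off-in (all→p (proj₁ square) (Good.vp F)) (noDigons pz)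

        out-of-a-off : ∀ {z} → Arc a z → z ≢ b → All (z ≢_) (d ∷ c ∷ b ∷ a ∷ [])
        out-of-a-off az z≢b =
          (λ { refl → noDigons az (Good.vs I) }) ∷ (λ { refl → no-shortcut F G az }) ∷ z≢b
            ∷ ≢-sym (arc⇒≢ az) ∷ []

        -- Any other out-neighbour `z′` of `z` in N⁺(a) would end the forbidden path
        -- `a → b → c → d → p → z → z′`.
        side-to-next : k ≡ 6 → ∀ {z} → Arc p z → Arc a z → Arc z b
        side-to-next k≡6 {z} pz az with out-within (Good.min F) az
        ... | z′ , az′ , zz′ with z′ ≟ b
        ... | yes refl = zz′
        ... | no z′≢b = contradiction az′ (antiTransitive
          (fresh▷ (to-p-z square (Good.vp F) pz) zz′
            (≢-sym (arc⇒≢ zz′) ∷ (λ { refl → noDigons pz zz′ }) ∷ out-of-a-off az′ z′≢b))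
          (sym k≡6))


      -- Two common out-neighbours `z` and `z′` of `a` and `p` give the path
      -- `a → z → b → c → z′ → d → p`.
      no-square-6 : k ≡ 6 → ∀ {a b c d} → Good p a b → Good p b c → Good p c d → ¬ Good p d a
      no-square-6 k≡6 {a} {b} {c} {d} F G H I with out-within (Good.min F) (Good.vp F)
      ... | z , az , pz with another-on-side F G z
      ... | z′ , z′≢z , az′ , pz′
        with square F G H I | off-square F G H I pz | off-square F G H I pz′
      ... | _ , (d≢c ∷ d≢b ∷ d≢a ∷ []) ∷ (c≢b ∷ c≢a ∷ []) ∷ (b≢a ∷ []) ∷ _
          | z≢d ∷ z≢c ∷ z≢b ∷ z≢a ∷ [] | z′≢d ∷ z′≢c ∷ z′≢b ∷ z′≢a ∷ [] =
        antiTransitive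
          ( (stop ▷ az ▷ side-to-next F G H I k≡6 pz az ▷ Good.vs G ▷ cz′
                  ▷ side-to-next H I F G k≡6 pz′ cz′ ▷ Good.sp H)
          , (≢-sym (arc⇒≢ (Good.sp H)) ∷ arc⇒≢ pz′ ∷ ≢-sym (arc⇒≢ (Good.vp H)) ∷ ≢-sym (arc⇒≢ (Good.vp G))
               ∷ arc⇒≢ pz ∷ ≢-sym (arc⇒≢ (Good.vp F)) ∷ [])
          ∷ (≢-sym z′≢d ∷ d≢c ∷ d≢b ∷ ≢-sym z≢d ∷ d≢a ∷ [])
          ∷ (z′≢c ∷ z′≢b ∷ z′≢z ∷ z′≢a ∷ [])
          ∷ (c≢b ∷ ≢-sym z≢c ∷ c≢a ∷ [])
          ∷ (≢-sym z≢b ∷ b≢a ∷ []) ∷ (z≢a ∷ []) ∷ [] ∷ [])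
          (sym k≡6) (Good.vp F)
        where
        cz′ : Arc c z′
        cz′ = same-side F G pz′ az′

      -- If `z₂` is not `b`, the path `a → b → c → d → p → z → z₁ → z₂` is forbidden; otherwise
      -- `a → z → z₁ → b → c → d → p → z′` is.
      no-square-7 : k ≡ 7 → ∀ {a b c d} → Good p a b → Good p b c → Good p c d → ¬ Good p d a
      no-square-7 k≡7 {a} {b} {c} {d} F G H I with out-within (Good.min F) (Good.vp F)
      ... | z , az , pz with out-within (Good.min F) az | another-on-side F G z
      ... | z₁ , az₁ , zz₁ | z′ , z′≢z , az′ , pz′ with out-within (Good.min F) az₁
      ... | z₂ , az₂ , z₁z₂
        with square F G H I | off-square F G H I pz | off-square F G H I pz′
           | off-in (all→p (proj₁ (square F G H I)) (Good.vp F))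
                    (λ z₁p → <⇒≱ ≤-refl (girth≥ {4} (≤-reflexive (sym k≡7)) (stop ▷ pz ▷ zz₁) z₁p))
           | z₂ ≟ b
      ... | sq | _ | _ | z₁-off | no z₂≢b =
        antiTransitive
          (fresh▷ (fresh▷ (to-p-z sq (Good.vp F) pz) zz₁
            (≢-sym (arc⇒≢ zz₁) ∷ (λ { refl → noDigons pz zz₁ }) ∷ z₁-off)) z₁z₂
            (≢-sym (arc⇒≢ z₁z₂) ∷ (λ { refl → noDigons zz₁ z₁z₂ }) ∷
             (λ { refl → <⇒≱ ≤-refl (girth≥ {4} (≤-reflexive (sym k≡7)) (stop ▷ pz ▷ zz₁) z₁z₂) }) ∷
             out-of-a-off F G H I az₂ z₂≢b))
          (sym k≡7) az₂
      ... | _ , (d≢c ∷ d≢b ∷ d≢a ∷ []) ∷ (c≢b ∷ c≢a ∷ []) ∷ (b≢a ∷ []) ∷ _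
          | z≢d ∷ z≢c ∷ z≢b ∷ z≢a ∷ [] | z′≢d ∷ z′≢c ∷ z′≢b ∷ z′≢a ∷ []
          | z₁≢d ∷ z₁≢c ∷ z₁≢b ∷ z₁≢a ∷ [] | yes refl =
        antiTransitive
          ( (stop ▷ az ▷ zz₁ ▷ z₁z₂ ▷ Good.vs G ▷ Good.vs H ▷ Good.sp H ▷ pz′)
          , (≢-sym (arc⇒≢ pz′) ∷ z′≢d ∷ z′≢c ∷ z′≢b ∷ z′≢z₁ ∷ z′≢z ∷ z′≢a ∷ [])
          ∷ (≢-sym (arc⇒≢ (Good.sp H)) ∷ ≢-sym (arc⇒≢ (Good.vp H)) ∷ ≢-sym (arc⇒≢ (Good.vp G))
               ∷ (λ { refl → noDigons pz zz₁ }) ∷ arc⇒≢ pz ∷ ≢-sym (arc⇒≢ (Good.vp F)) ∷ [])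
          ∷ (d≢c ∷ d≢b ∷ ≢-sym z₁≢d ∷ ≢-sym z≢d ∷ d≢a ∷ [])
          ∷ (c≢b ∷ ≢-sym z₁≢c ∷ ≢-sym z≢c ∷ c≢a ∷ [])
          ∷ (≢-sym z₁≢b ∷ ≢-sym z≢b ∷ b≢a ∷ [])
          ∷ (≢-sym (arc⇒≢ zz₁) ∷ z₁≢a ∷ []) ∷ (z≢a ∷ []) ∷ [] ∷ [])
          (sym k≡7) az′
        where
        z′≢z₁ : z′ ≢ z₁
        z′≢z₁ refl = <⇒≱ ≤-refl (girth≥ {4} (≤-reflexive (sym k≡7)) (stop ▷ pz′ ▷ z₁z₂) (Good.sp F))

      k-range : ∀ {x ys y} → Path (Good p) x ys y → Good p y x →
                k ≡ 2 + length ys ⊎ k ≡ 3 + length ys ⊎ k ≡ 4 + length ys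
      k-range path@(walk , _) G
        with m≤n⇒m<n∨m≡n (good-path-length path (Good.sp G)) | girth≥k-3 (arcs walk) (Good.vs G)
      ... | inj₂ eq | _ = inj₁ (sym eq)
      ... | inj₁ lt | le with m≤n⇒m<n∨m≡n lt
      ... | inj₂ eq = inj₂ (inj₁ (sym eq))
      ... | inj₁ lt′ = inj₂ (inj₂ (≤-antisym le lt′))

      no-good-cycle : ∀ {x ys y} → Path (Good p) x ys y → ¬ Good p y x
      no-good-cycle (stop , _) G = noLoops (Good.vs G)
      no-good-cycle (stop ▷ F , _) G = noDigons (Good.vs F) (Good.vs G)
      no-good-cycle (stop ▷ E ▷ F , _) G = no-triangle E F G
      -- On four vertices `k` may be 6 or 7, where the girth is too small for `k≢3+` and `k≢4+`.
      no-good-cycle path@(walk@(stop ▷ D₁ ▷ E ▷ F) , u) G with k-range path G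
      ... | inj₁ k≡5        = Cycle.k≢2+ walk u G k≡5
      ... | inj₂ (inj₁ k≡6) = no-square-6 k≡6 D₁ E F G
      ... | inj₂ (inj₂ k≡7) = no-square-7 k≡7 D₁ E F G
      no-good-cycle path@(walk@(_▷_ {ys = ys} (_ ▷ _ ▷ _ ▷ _) F) , u) G with k-range path G
      ... | inj₁ k≡         = Cycle.k≢2+ walk u G k≡
      ... | inj₂ (inj₁ k≡)  =
        Cycle.k≢3+ walk u G (girth≥ {4} (≤-trans (m≤m+n 7 _) (≤-reflexive (sym k≡)))) k≡
      ... | inj₂ (inj₂ k≡)  =
        Cycle.k≢4+ walk u G (girth≥ {5} (≤-trans (m≤m+n 8 _) (≤-reflexive (sym k≡)))) k≡

      good-walk : ∀ {v s} → Good p v s → ∀ n →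
                  ∃₂ λ ys y → Walk (Good p) v ys y × length ys ≡ n × ∃ (Good p y)
      good-walk G zero = [] , _ , stop , refl , _ , G
      good-walk G (suc n) with good-walk G n
      ... | ys , y , walk , refl , z , H = y ∷ ys , z , (walk ▷ H) , refl , good-next H

    no-good : ∀ {p v s} → ¬ Good p v s
    no-good {p} G with SoleTarget.good-walk p G k
    ... | ys , y , walk , len , _ = <⇒≱ (n<1+n _)
      (≤-trans (<⇒≤ (SoleTarget.good-path-length p (acyclic-walk-path _≟_ acyclic walk) (Good.vp G)))
               (≤-reflexive (sym len)))
      where
      all-girths : ∀ g → Girth≥ (Good p) g
      all-girths zero    _ _ = z≤n
      all-girths (suc g) = Girth≥-suc _≟_ (all-girths g) λ path H _ → SoleTarget.no-good-cycle p path H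
      acyclic : ∀ {x ys y} → Walk (Good p) x ys y → ¬ Good p y x
      acyclic w H = <-irrefl refl (all-girths _ w H)

    -- The relation induced on N⁺(v)

    module _ {v} (min : Min v) where

      R : Rel Vertex 0ℓ
      R = Within (Arc v)

      R-asym : ∀ {x y} → R x y → ¬ R y x
      R-asym (_ , xy , _) (_ , yx , _) = noDigons xy yx

      -- A single out-neighbour of `y` in N⁺(v) would yield a good arc from `v` to `y`.
      R-other : ∀ {x y} → R x y → ∀ c → ∃ λ a → a ≢ c × R y a
      R-other {y = y} (_ , _ , vy) c
        with any? (λ a → ¬? (a ≟ c) ×-dec arc? v a ×-dec arc? y a) | out-within min vy
      ... | yes (a , a≢c , va , ya) | _ = a , a≢c , vy , ya , va
      ... | no none | a , va , ya =
        ⊥-elim (no-good (good min vy (subst (Arc v) (a≡c va ya) va) (subst (Arc y) (a≡c va ya) ya) a≡c))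
        where
        a≡c : ∀ {a} → Arc v a → Arc y a → a ≡ c
        a≡c {a} va ya with a ≟ c
        ... | yes eq = eq
        ... | no neq = contradiction (a , neq , va , ya) none

      open MinOutDegree2 _≟_ R R-asym R-other

      R-walk-within : ∀ {x ys y} → Walk R x ys y → Arc v x → All (Arc v) (y ∷ ys)
      R-walk-within stop                  vx = vx ∷ []
      R-walk-within walk@(_ ▷ (_ , _ , vy)) _ = within-all walk vy

      from-v : ∀ {x ys y} → Path R x ys y → Arc v x → Path Arc v (ys ++ v ∷ []) y
      from-v (walk , u) vx =
        path-join {P = _≡ v} (stop , [] ∷ []) (refl ∷ []) vx (map-walk (proj₁ ∘ proj₂) walk , u)
          (All.map (λ va a≡v → noLoops (subst (Arc v) a≡v va)) (R-walk-within walk vx))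

      R-path-length : ∀ {x ys y} → Path R x ys y → Arc v x → suc (length ys) < k
      R-path-length {ys = ys} path vx with suc (suc (length ys)) ≤? k
      ... | yes l = l
      ... | no ¬l with initial (k ∸ 1) (∸-monoˡ-≤ 1 (≤-pred (≰⇒> ¬l))) path
      ... | zs , z , path′@(walk , _) , len = contradiction (All.head (R-walk-within walk vx))
        (antiTransitive (from-v path′ vx)
          (trans (length-++ zs) (trans (+-comm (length zs) 1) (trans (cong suc len) (m+[n∸m]≡n 1≤k)))))

      noLongPath : ∀ {x ys y} → Path R x ys y → suc (length ys) < k
      -- A one-vertex path may lie outside N⁺(v), so the bound `1 < k` is taken from an
      -- out-neighbour of `v`.
      noLongPath (stop , _) with out v
      ... | u , vu = R-path-length (stop , [] ∷ []) vu
      noLongPath path@(walk@(_ ▷ _) , _) with first-arc walk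
      ... | _ , _ , (vx , _) , _ = R-path-length path vx

      -- A regular tournament inside N⁺(v)

      module _ (five : 5 ≤ ∣ Out v ∣) where

        out-deg : ∀ {s b c} → (∀ {z} → R s z → z ≡ b ⊎ z ≡ c) → Arc v s →
                  ∣ Out s ∣ ≤ 2 + ∣ Out s ∩ Out² v ∣
        out-deg {s} {b} {c} outs vs = ≤-trans
          (p⊆⁅x⁆∪q⇒∣p∣≤1+∣q∣ {q = ⁅ c ⁆ ∪ (Out s ∩ Out² v)} b λ m z≢b → covered m z≢b)
          (s≤s (≤-trans (∣∪∣≤ ⁅ c ⁆ (Out s ∩ Out² v))
                        (≤-reflexive (cong (_+ ∣ Out s ∩ Out² v ∣) (∣⁅x⁆∣≡1 c)))))
          where
          covered : ∀ {z} → z ∈ Out s → z ≢ b → z ∈ ⁅ c ⁆ ∪ (Out s ∩ Out² v)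
          covered {z} m z≢b with arc? v z
          ... | no ¬vz = x∈p∪q⁺ (inj₂ (x∈p∩q⁺ (m , second⇒∈Out² vs (∈Out⇒arc m) ¬vz)))
          ... | yes vz with outs (vs , ∈Out⇒arc m , vz)
          ... | inj₁ z≡b  = contradiction z≡b z≢b
          ... | inj₂ refl = x∈p∪q⁺ (inj₁ (x∈⁅x⁆ z))

        -- With `d = ∣ Out v ∣`, the sets `S` and `T` have at least `d - 2` elements each inside a
        -- set of at most `d - 1`. They share at least `d - 3 ≥ 2` elements, one of which is not
        -- `w`.
        common-out : ∀ {s b c t b′ c′} → Arc v s → (∀ {z} → R s z → z ≡ b ⊎ z ≡ c) →
                     Arc v t → (∀ {z} → R t z → z ≡ b′ ⊎ z ≡ c′) →
                     ∀ w → ∃ λ w′ → w′ ≢ w × w′ ∈ Out² v × Arc s w′ × Arc t w′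
        common-out {s} {t = t} vs s-outs vt t-outs w
          with any? (λ w′ → ¬? (w′ ≟ w) ×-dec (w′ ∈? Out² v) ×-dec arc? s w′ ×-dec arc? t w′)
        ... | yes found = found
        ... | no  none  = contradiction five (<⇒≱ (s≤s d≤4))
          where
          d = ∣ Out v ∣
          S T : Subset order
          S = Out s ∩ Out² v
          T = Out t ∩ Out² v
          S∩T≤1 : ∣ S ∩ T ∣ ≤ 1
          S∩T≤1 = ≤-trans (p⊆q⇒∣p∣≤∣q∣ {q = ⁅ w ⁆} (λ {z} m → in-w m)) (≤-reflexive (∣⁅x⁆∣≡1 w))
            where
            in-w : ∀ {z} → z ∈ S ∩ T → z ∈ ⁅ w ⁆
            in-w {z} m with z ≟ w
            ... | yes refl = x∈⁅x⁆ z
            ... | no  z≢w with x∈p∩q⁻ S T m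
            ... | zS , zT with x∈p∩q⁻ (Out s) (Out² v) zS | x∈p∩q⁻ (Out t) (Out² v) zT
            ... | zs , z² | zt , _ = contradiction (z , z≢w , z² , ∈Out⇒arc zs , ∈Out⇒arc zt) none
          S∪T≤ : ∣ S ∪ T ∣ ≤ ∣ Out² v ∣
          S∪T≤ = p⊆q⇒∣p∣≤∣q∣ λ m →
            [ (λ mS → proj₂ (x∈p∩q⁻ (Out s) (Out² v) mS)) , (λ mT → proj₂ (x∈p∩q⁻ (Out t) (Out² v) mT)) ]′
              (x∈p∪q⁻ S T m)
          d≤4 : d ≤ 4
          d≤4 = +-cancelˡ-≤ d d 4 (begin
            d + d                       ≤⟨ +-mono-≤ (≤-trans (min s) (out-deg s-outs vs))
                                                    (≤-trans (min t) (out-deg t-outs vt)) ⟩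
            2 + ∣ S ∣ + (2 + ∣ T ∣)      ≡⟨ cong (2 +_) (trans (+-suc ∣ S ∣ _) (cong suc (+-suc ∣ S ∣ _))) ⟩
            4 + (∣ S ∣ + ∣ T ∣)          ≤⟨ +-monoʳ-≤ 4 (∣p∣+∣q∣≤∣p∪q∣+∣p∩q∣ S T) ⟩
            4 + (∣ S ∪ T ∣ + ∣ S ∩ T ∣)  ≤⟨ +-monoʳ-≤ 4 (+-mono-≤ S∪T≤ S∩T≤1) ⟩
            4 + (∣ Out² v ∣ + 1)        ≡⟨ cong (4 +_) (+-comm ∣ Out² v ∣ 1) ⟩
            4 + suc ∣ Out² v ∣          ≤⟨ +-monoʳ-≤ 4 (noSeymour v) ⟩
            4 + d                       ≡⟨ +-comm 4 d ⟩
            d + 4                       ∎)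
            where open ≤-Reasoning

      module _ (k≤6 : k ≤ 6) where

        open NoSixVertexPath (λ path → ≤-pred (≤-trans (noLongPath path) k≤6))

        module _ {a b c d e} (T : Tournament₅ a b c d e) where

          open Tournament₅ T

          e∷d∷c∷b∷a-distinct : Unique (e ∷ d ∷ c ∷ b ∷ a ∷ [])
          e∷d∷c∷b∷a-distinct =
            (≢-sym (R⇒≢ de) ∷ ≢-sym (R⇒≢ ce) ∷ R⇒≢ eb ∷ R⇒≢ ea ∷ []) ∷
            (≢-sym (R⇒≢ cd) ∷ ≢-sym (R⇒≢ bd) ∷ R⇒≢ da ∷ []) ∷
            (≢-sym (R⇒≢ bc) ∷ ≢-sym (R⇒≢ ac) ∷ []) ∷ (≢-sym (R⇒≢ ab) ∷ []) ∷ [] ∷ []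

          k≡6 : k ≡ 6
          k≡6 = ≤-antisym k≤6 (noLongPath (stop ▷ ab ▷ bc ▷ cd ▷ de , e∷d∷c∷b∷a-distinct))

          va = proj₁ ab
          vb = proj₁ bc
          vc = proj₁ cd
          vd = proj₁ de
          ve = proj₁ ea

          five : 5 ≤ ∣ Out v ∣
          five = length≤∣p∣ (a ∷ b ∷ c ∷ d ∷ e ∷ []) (distinct-tournament₅ T)
            (arc⇒∈Out va ∷ arc⇒∈Out vb ∷ arc⇒∈Out vc ∷ arc⇒∈Out vd ∷ arc⇒∈Out ve ∷ [])

          outs-a : ∀ {z} → R a z → z ≡ b ⊎ z ≡ c
          outs-a = outs-tournament₅ T

          T-d : Tournament₅ d e a b c
          T-d = rotate-tournament₅ (rotate-tournament₅ (rotate-tournament₅ T))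

          outs-d : ∀ {z} → R d z → z ≡ e ⊎ z ≡ a
          outs-d = outs-tournament₅ T-d

          outs-e : ∀ {z} → R e z → z ≡ a ⊎ z ≡ b
          outs-e = outs-tournament₅ (rotate-tournament₅ T-d)

          arc : ∀ {x y} → R x y → Arc x y
          arc = proj₁ ∘ proj₂

          Out²≢Out : ∀ {w x} → w ∈ Out² v → Arc v x → w ≢ x
          Out²≢Out w∈ vx refl = ∈Out²⇒¬arc w∈ vx

          -- Otherwise `a → w → x → y → z → t → w′` is forbidden, with `w′` a further common
          -- out-neighbour of `a` and `t`.
          no-return : ∀ {w x y z t t₁ t₂} → w ∈ Out² v → Arc a w → R x y → R y z → R z t →
                      Unique (t ∷ z ∷ y ∷ x ∷ a ∷ []) → (∀ {u} → R t u → u ≡ t₁ ⊎ u ≡ t₂) → ¬ Arc w x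
          no-return {w} w∈ aw xy yz zt
            ((t≢z ∷ t≢y ∷ t≢x ∷ t≢a ∷ []) ∷ (z≢y ∷ z≢x ∷ z≢a ∷ []) ∷ (y≢x ∷ y≢a ∷ []) ∷ (x≢a ∷ []) ∷ _)
            outs-t wx
            with common-out five va outs-a (proj₂ (proj₂ zt)) outs-t w
          ... | w′ , w′≢w , w′∈ , aw′ , tw′ = antiTransitive
            ( (stop ▷ aw ▷ wx ▷ arc xy ▷ arc yz ▷ arc zt ▷ tw′)
            , (Out²≢Out w′∈ vt ∷ Out²≢Out w′∈ vz ∷ Out²≢Out w′∈ vy ∷ Out²≢Out w′∈ vx ∷ w′≢w
                 ∷ Out²≢Out w′∈ va ∷ [])
            ∷ (t≢z ∷ t≢y ∷ t≢x ∷ ≢-sym (Out²≢Out w∈ vt) ∷ t≢a ∷ [])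
            ∷ (z≢y ∷ z≢x ∷ ≢-sym (Out²≢Out w∈ vz) ∷ z≢a ∷ [])
            ∷ (y≢x ∷ ≢-sym (Out²≢Out w∈ vy) ∷ y≢a ∷ [])
            ∷ (≢-sym (Out²≢Out w∈ vx) ∷ x≢a ∷ [])
            ∷ (Out²≢Out w∈ va ∷ []) ∷ [] ∷ [])
            (sym k≡6) aw′
            where
            vx = proj₁ xy
            vy = proj₁ yz
            vz = proj₁ zt
            vt = proj₂ (proj₂ zt)

          -- A common out-neighbour w ∈ N⁺⁺(v) of a and e has N⁺(w) ⊊ N⁺⁺(a), as e is
          -- missing from N⁺(w); this makes the out-degree of w too small.
          noTournament₅ : ⊥
          -- The vertex to be avoided is immaterial; `v` is an arbitrary choice.
          noTournament₅ with common-out five va outs-a ve outs-e v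
          ... | w , _ , w∈ , aw , ew = contradiction (min w) (<⇒≱ (≤-trans (s≤s out-w≤) (noSeymour v)))
            where
            e∈Out²a : e ∈ Out² a
            e∈Out²a = second⇒∈Out² (arc ac) (arc ce) (noDigons (arc ea))
            out-w⊆ : Out w ⊆ Out² a
            out-w⊆ {u} m = second⇒∈Out² aw wu ¬au
              where
              wu : Arc w u
              wu = ∈Out⇒arc m
              ¬au : ¬ Arc a u
              ¬au au with arc? v u
              ... | yes vu with outs-a (va , au , vu)
              ... | inj₁ refl = no-return w∈ aw bc cd de e∷d∷c∷b∷a-distinct outs-e wu
              ... | inj₂ refl = no-return w∈ aw ce eb bd
                ( (≢-sym (R⇒≢ bd) ∷ R⇒≢ de ∷ ≢-sym (R⇒≢ cd) ∷ R⇒≢ da ∷ [])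
                ∷ (≢-sym (R⇒≢ eb) ∷ R⇒≢ bc ∷ ≢-sym (R⇒≢ ab) ∷ [])
                ∷ (≢-sym (R⇒≢ ce) ∷ R⇒≢ ea ∷ []) ∷ (≢-sym (R⇒≢ ac) ∷ []) ∷ [] ∷ [])
                outs-d wu
              -- Here `u` lies in N⁺⁺(v), and `a → b → c → d → e → w → u` is forbidden.
              ¬au au | no ¬vu with e∷d∷c∷b∷a-distinct
              ... | distinct@(_ ∷ _) = antiTransitive
                (fresh▷ (fresh▷ (stop ▷ arc ab ▷ arc bc ▷ arc cd ▷ arc de , distinct)
                  ew (Out²≢Out w∈ ve ∷ Out²≢Out w∈ vd ∷ Out²≢Out w∈ vc ∷ Out²≢Out w∈ vb
                      ∷ Out²≢Out w∈ va ∷ []))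
                  wu (≢-sym (arc⇒≢ wu) ∷ Out²≢Out u∈ ve ∷ Out²≢Out u∈ vd ∷ Out²≢Out u∈ vc ∷ Out²≢Out u∈ vb
                      ∷ Out²≢Out u∈ va ∷ []))
                (sym k≡6) au
                where
                u∈ : u ∈ Out² v
                u∈ = second⇒∈Out² va au ¬vu
            out-w≤ : ∣ Out w ∣ ≤ ∣ Out² v ∣
            out-w≤ = ≤-pred (≤-pred (begin
              2 + ∣ Out w ∣             ≤⟨ s≤s (p⊂q⇒∣p∣<∣q∣
                                             (out-w⊆ , e , e∈Out²a , λ m → noDigons ew (∈Out⇒arc m))) ⟩
              1 + ∣ Out² a ∣            ≤⟨ noSeymour a ⟩
              ∣ Out a ∣                 ≤⟨ out-deg five outs-a va ⟩
              2 + ∣ Out a ∩ Out² v ∣    ≤⟨ +-monoʳ-≤ 2 (∣p∩q∣≤∣q∣ (Out a) (Out² v)) ⟩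
              2 + ∣ Out² v ∣            ∎))
              where open ≤-Reasoning

      no-min : ⊥
      no-min with out v
      ... | x , vx with out-within min vx
      -- From `k = 7` on the girth bound excludes triangles; below, paths in N⁺(v) have at most five
      -- vertices.
      ... | y , vy , xy with 7 ≤? k
      ... | no ¬7≤k = NoSixVertexPath.noArc-noTournament₅ (λ path → ≤-pred (≤-trans (noLongPath path) k≤6))
        (noTournament₅ k≤6) (vx , xy , vy)
        where
        k≤6 : k ≤ 6
        k≤6 = ≤-pred (≰⇒> ¬7≤k)
      ... | yes 7≤k = noArc-triangleFree k
        (λ (_ , a , _) (_ , b , _) (_ , c , _) → <⇒≱ ≤-refl (girth≥ {4} 7≤k (stop ▷ a ▷ b) c))
        (λ walk (_ , c , _) → girth≥k-3 (map-walk (proj₁ ∘ proj₂) walk) c)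
        noLongPath (vx , xy , vy)

-- Conclusion

someVertex : (D : Digraph) → Digraph.Vertex D
someVertex record { order = suc n } = zero

noSeymour-contradiction : (k : ℕ) → .{{_ : NonZero k}} →
  (D : Digraph) → IsOriented D →
  AntiTransitive D k → Free D (k ∸ 4) →
  ¬ (∀ v → d⁺⁺ D v < d⁺ D v)
noSeymour-contradiction k D oriented anti free noSeymour = no-min (proj₂ (minimum (someVertex D)))
  where
  open OrientedDigraph D oriented
  open NoSeymourVertex D oriented (N⁺ D) (N⁺⁺ D)
    arc⇒∈N⁺ ∈N⁺⇒arc second⇒∈N⁺⁺ ∈N⁺⁺⇒¬arc noSeymour
  open AntiTransitiveFree k (>-nonZero⁻¹ k)
    (λ path len → anti _ _ (subst (DirectedPath D _ _) len (path⇒directedPath path)))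
    -- The inequality `k ≤ 4 + (k ∸ 4)` also covers `k < 4`, where the subtraction is truncated.
    (λ walk a → ≤-trans (m≤n+m∸n k 4) (+-monoʳ-≤ 4 (≤-pred (free⇒girth≥ (k ∸ 4) free walk a))))

theorem3p1 : (k : ℕ) → .{{_ : NonZero k}} →
    (D : Digraph) → IsOriented D →
    AntiTransitive D k → Free D (k ∸ 4) →
    ∃ λ v → SeymourVertex D v
theorem3p1 k D oriented anti free = decidable-stable (any? λ v → d⁺ D v ≤? d⁺⁺ D v) λ none →
  noSeymour-contradiction k D oriented anti free λ v → ≰⇒> λ seymour → none (v , seymour)
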